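{- There is an algorithm that solves \textsc{Rendezvous} in time $n^{\mathcal{O}(k)}$, and an algorithm that solves \textsc{Rendezvous in Time} in time $n^{\mathcal{O}(k)}$, where $n=|V(G)|$ is the number of vertices of the input graph and $k$ is the number of Divider's agents (in \textsc{Rendezvous in Time}, $\tau$ is given in binary).
   Context: Rendezvous game with adversaries. Let $G$ be a finite, simple, undirected, connected graph, let $s,t\in V(G)$ and let $k\ge 1$ be an integer. Two players play: Facilitator, who controls two agents $R$ and $J$ initially placed on $s$ and $t$ respectively, and Divider, who controls $k$ agents $D_1,\dots,D_k$ which Divider initially places on vertices of $V(G)\setminus\{s,t\}$ of his choice (several agents may share a vertex). After the initial placement the players alternate moves, Facilitator moving first. In a move, the player moves each of his agents to an adjacent vertex or leaves it where it is; no agent may be moved to a vertex currently occupied by an agent of the opponent. Both players have full information. Facilitator wins if at some moment $R$ and $J$ occupy the same vertex; Divider wins if this never happens. For an integer $\tau\ge 1$, Facilitator wins in at most $\tau$ steps if he can force $R$ and $J$ to occupy the same vertex within his first $\tau$ moves (a step is a move of Facilitator followed by a move of Divider). \textsc{Rendezvous}: given $(G,s,t,k)$, decide whether Facilitator has a winning strategy against Divider with $k$ agents. \textsc{Rendezvous in Time}: given $(G,s,t,k,\tau)$ with positive integers $k,\tau$, decide whether Facilitator can win in at most $\tau$ steps against Divider with $k$ agents. -}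

module Defs where

open import Data.Bool.Base using (Bool; true; false; T; if_then_else_)
open import Data.Fin.Base using (Fin; toℕ)
open import Data.List.Base using (List; []; _∷_; foldr; replicate; tabulate)
open import Data.Nat.Base using (ℕ; zero; suc; _+_; _≤_; _≡ᵇ_)
open import Data.Nat.Binary.Base using (ℕᵇ; 2[1+_]; 1+[2_]; fromℕ)
  renaming (zero to 0ᵇ)
open import Data.Product.Base using (Σ-syntax; ∃-syntax; _×_; _,_; proj₁; proj₂)
open import Data.Sum.Base using (_⊎_)
open import Data.Vec.Base using (Vec; []; _∷_)
open import Data.Vec.Membership.Propositional using (_∉_)
open import Data.Vec.Relation.Binary.Pointwise.Inductive using (Pointwise)
open import Relation.Binary.Construct.Closure.ReflexiveTransitive using (Star)
open import Relation.Binary.PropositionalEquality.Core using (_≡_; _≢_)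
open import Relation.Nullary.Negation.Core using (¬_)

record ConnectedGraph (n : ℕ) : Set where
  field
    adj         : Fin n → Fin n → Bool
    symmetric   : ∀ u v → adj u v ≡ adj v u
    irreflexive : ∀ v → adj v v ≡ false

  Adjacent : Fin n → Fin n → Set
  Adjacent u v = T (adj u v)

  field
    connected   : ∀ u v → Star Adjacent u v

module Game {n : ℕ} (G : ConnectedGraph n) (s t : Fin n) (k : ℕ) where
  open ConnectedGraph G

  V : Set
  V = Fin n

  record Position : Set where
    constructor position
    field
      R J : V
      D   : Vec V k

  open Position public

  -- One agent goes from u to v while the opponent's agents occupy opp.
  AgentMove : ∀ {m} → Vec V m → V → V → Set
  AgentMove opp u v = v ≡ u ⊎ (Adjacent u v × v ∉ opp)

  FacilitatorMove : Position → Set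
  FacilitatorMove p =
    Σ[ (r , j) ∈ V × V ] AgentMove (D p) (R p) r × AgentMove (D p) (J p) j

  DividerMove : Position → Set
  DividerMove p =
    Σ[ d ∈ Vec V k ] Pointwise (AgentMove (R p ∷ J p ∷ [])) (D p) d

  afterFacilitator : (p : Position) → FacilitatorMove p → Position
  afterFacilitator p ((r , j) , _) = position r j (D p)

  afterDivider : (p : Position) → DividerMove p → Position
  afterDivider p (d , _) = position (R p) (J p) d

  -- A strategy sees all previous positions (latest first) and the
  -- current one.
  FacilitatorStrategy : Set
  FacilitatorStrategy = List Position → (p : Position) → FacilitatorMove p

  record DividerStrategy : Set where
    field
      placement : Vec V k
      avoids-s  : s ∉ placement
      avoids-t  : t ∉ placement
      respond   : List Position → (p : Position) → DividerMove p

  open DividerStrategy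

  -- The history and the position after i steps, a step being a move of
  -- Facilitator followed by a move of Divider.
  play : FacilitatorStrategy → DividerStrategy → ℕ → List Position × Position
  play σ δ zero    = [] , position s t (placement δ)
  play σ δ (suc i) =
    let h , p = play σ δ i
        q     = afterFacilitator p (σ h p)
        p′    = afterDivider q (respond δ (p ∷ h) q)
    in  q ∷ p ∷ h , p′

  -- Divider's moves do not affect R and J, so R and J meet after i steps
  -- exactly if they met right after Facilitator's i-th move (or
  -- initially, for i = 0).
  MetAfter : FacilitatorStrategy → DividerStrategy → ℕ → Set
  MetAfter σ δ i = R p ≡ J p
    where p = proj₂ (play σ δ i)

  FacilitatorWins : Set
  FacilitatorWins =
    Σ[ σ ∈ FacilitatorStrategy ] ∀ (δ : DividerStrategy) → ∃[ i ] MetAfter σ δ i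

  FacilitatorWinsWithin : ℕ → Set
  FacilitatorWinsWithin τ =
    Σ[ σ ∈ FacilitatorStrategy ] ∀ (δ : DividerStrategy) →
      ∃[ i ] i ≤ τ × MetAfter σ δ i

-- Model of computation: Jones' language WHILE (N. D. Jones,
-- "Computability and Complexity", 1997).  Data are binary trees, held in
-- variables as pointers, so that every primitive operation takes constant
-- time on a pointer machine although a cons may share its arguments.  Up
-- to a polynomial, this time measure is that of Turing machines and of
-- random access machines with logarithmic cost.

infixr 5 _∙_

data Tree : Set where
  nil : Tree
  _∙_ : Tree → Tree → Tree

left right : Tree → Tree
left  nil     = nil
left  (a ∙ b) = a
right nil     = nil
right (a ∙ b) = b

Var : Set
Var = ℕ

Store : Set
Store = Var → Tree

_[_↦_] : Store → Var → Tree → Store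
(ρ [ x ↦ a ]) y = if x ≡ᵇ y then a else ρ y

data Expr : Set where
  var   : Var → Expr
  nil   : Expr
  cons  : Expr → Expr → Expr
  hd tl : Expr → Expr

eval : Expr → Store → Tree
eval (var x)    ρ = ρ x
eval nil        ρ = nil
eval (cons e f) ρ = eval e ρ ∙ eval f ρ
eval (hd e)     ρ = left (eval e ρ)
eval (tl e)     ρ = right (eval e ρ)

cost : Expr → ℕ
cost (var x)    = 1
cost nil        = 1
cost (cons e f) = 1 + cost e + cost f
cost (hd e)     = 1 + cost e
cost (tl e)     = 1 + cost e

infixr 4 _⨾_
infix  5 _≔_

data Program : Set where
  _≔_   : Var → Expr → Program
  _⨾_   : Program → Program → Program
  ifte  : Expr → Program → Program → Program
  while : Expr → Program → Program

-- ⟨ P , ρ ⟩⇓[ m ] ρ′ : started in the store ρ, the program P halts after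
-- m units of time in the store ρ′.  As a test, nil is false and every
-- other tree is true.
infix 3 ⟨_,_⟩⇓[_]_

data ⟨_,_⟩⇓[_]_ : Program → Store → ℕ → Store → Set where
  assign     : ∀ {x e ρ} →
               ⟨ x ≔ e , ρ ⟩⇓[ 1 + cost e ] ρ [ x ↦ eval e ρ ]
  seq        : ∀ {P Q ρ ρ′ ρ″ a b} →
               ⟨ P , ρ ⟩⇓[ a ] ρ′ → ⟨ Q , ρ′ ⟩⇓[ b ] ρ″ →
               ⟨ P ⨾ Q , ρ ⟩⇓[ a + b ] ρ″
  ifte-true  : ∀ {e P Q ρ ρ′ a} → eval e ρ ≢ nil →
               ⟨ P , ρ ⟩⇓[ a ] ρ′ →
               ⟨ ifte e P Q , ρ ⟩⇓[ 1 + cost e + a ] ρ′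
  ifte-false : ∀ {e P Q ρ ρ′ a} → eval e ρ ≡ nil →
               ⟨ Q , ρ ⟩⇓[ a ] ρ′ →
               ⟨ ifte e P Q , ρ ⟩⇓[ 1 + cost e + a ] ρ′
  while-true : ∀ {e P ρ ρ′ ρ″ a b} → eval e ρ ≢ nil →
               ⟨ P , ρ ⟩⇓[ a ] ρ′ → ⟨ while e P , ρ′ ⟩⇓[ b ] ρ″ →
               ⟨ while e P , ρ ⟩⇓[ 1 + cost e + a + b ] ρ″
  while-done : ∀ {e P ρ} → eval e ρ ≡ nil →
               ⟨ while e P , ρ ⟩⇓[ 1 + cost e ] ρ

initial : Tree → Store
initial a = (λ _ → nil) [ 0 ↦ a ]

output : Store → Tree
output ρ = ρ 0

encodeBool : Bool → Tree
encodeBool false = nil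
encodeBool true  = nil ∙ nil

encodeList : List Tree → Tree
encodeList = foldr _∙_ nil

-- Vertices are written in unary: the input contains the n² entries of the
-- adjacency matrix anyway.
encodeVertex : ∀ {n} → Fin n → Tree
encodeVertex v = encodeList (replicate (toℕ v) nil)

-- The list of digits of the library's binary numerals, the least
-- significant first.  These numerals have the digits 1 (false) and
-- 2 (true) instead of 0 and 1, which makes them unique; m has
-- ⌊log₂ (1 + m)⌋ of them.
encodeBinary : ℕᵇ → Tree
encodeBinary 0ᵇ       = nil
encodeBinary 1+[2 b ] = encodeBool false ∙ encodeBinary b
encodeBinary 2[1+ b ] = encodeBool true ∙ encodeBinary b

encodeℕ : ℕ → Tree
encodeℕ m = encodeBinary (fromℕ m)

encodeGraph : ∀ {n} → ConnectedGraph n → Tree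
encodeGraph G =
  encodeList (tabulate λ u → encodeList (tabulate λ v → encodeBool (adj u v)))
  where open ConnectedGraph G

record Problem : Set₁ where
  field
    Instance : Set
    encode   : Instance → Tree
    Yes      : Instance → Set

record DecidesInTime (P : Program) (Π : Problem)
                     (bound : Problem.Instance Π → ℕ) : Set where
  open Problem Π
  field
    decides : ∀ (I : Instance) →
      ∃[ m ] ∃[ ρ ] ⟨ P , initial (encode I) ⟩⇓[ m ] ρ
                  × m ≤ bound I
                  × ((output ρ ≡ encodeBool true  × Yes I) ⊎
                     (output ρ ≡ encodeBool false × ¬ Yes I))

record RendezvousInstance : Set where
  field
    n   : ℕ
    G   : ConnectedGraph n
    s t : Fin n
    k   : ℕ
    1≤k : 1 ≤ k

record RendezvousInTimeInstance : Set where
  field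
    rendezvousInstance : RendezvousInstance
    τ                  : ℕ
    1≤τ                : 1 ≤ τ
  open RendezvousInstance rendezvousInstance public

Rendezvous : Problem
Rendezvous = record
  { Instance = RendezvousInstance
  ; encode   = λ I → let open RendezvousInstance I in
      encodeList (encodeGraph G ∷ encodeVertex s ∷ encodeVertex t ∷ encodeℕ k ∷ [])
  ; Yes      = λ I → let open RendezvousInstance I in
      Game.FacilitatorWins G s t k
  }

RendezvousInTime : Problem
RendezvousInTime = record
  { Instance = RendezvousInTimeInstance
  ; encode   = λ I → let open RendezvousInTimeInstance I in
      encodeList (encodeGraph G ∷ encodeVertex s ∷ encodeVertex t ∷ encodeℕ k
                  ∷ encodeℕ τ ∷ [])
  ; Yes      = λ I → let open RendezvousInTimeInstance I in
      Game.FacilitatorWinsWithin G s t k τ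
  }

{-# OPTIONS --safe #-}
module Submission where

-- Let Win i be the set of positions from which Facilitator can win in at most i steps.  These sets increase, and each
-- determines the next, so they are constant from i = N on, where N = n² · n ^ k is the number of positions.  Facilitator
-- wins (within τ steps) iff all initial positions are in Win N (in Win (min N τ)): he follows the witnesses of membership,
-- and Divider stays in the complement.  The sets Win i are computed by brute force on lists of positions.
--
-- Running times are tracked by composing programs as morphisms A ⇒ B whose time and output size are bounded by polynomials
-- in a freely chosen measure of the input.  Measuring an instance by n ^ k turns "polynomial" into n ^ O(k).

open import Defs
open import Data.Bool.Base using (Bool; true; false; if_then_else_; T; _∧_; _∨_; not)
open import Data.Bool.ListAction using (any; all)
open import Data.Bool.Properties using (T?; ∧-zeroʳ; ∧-assoc; ∨-assoc; ∨-identityʳ; ∧-identityʳ)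
open import Data.Empty using (⊥-elim)
open import Data.Fin.Base as Fin using (Fin; toℕ; fromℕ<)
import Data.Fin.Properties as Fin
open import Data.List.Base as List
  using (List; []; _∷_; _++_; foldl; length; replicate; drop; null; filter; downFrom; tabulate; allFin; cartesianProductWith)
open import Data.List.Membership.Propositional using (_∈_; lose; find)
open import Data.List.Membership.Propositional.Properties
  using (∈-++⁺ˡ; ∈-cartesianProductWith⁺; ∈-allFin; ∈-downFrom⁺; ∈-downFrom⁻)
open import Data.List.Properties
  using (++-identityʳ; ++-assoc; foldl-++; filter-notAll; length-++; length-map; length-tabulate; length-downFrom; length-replicate)
open import Data.List.Relation.Unary.Any as Any using (Any; here; there)
open import Data.Maybe.Base using (Maybe; just; nothing; maybe)
open import Data.Nat.Base
open import Data.Nat.Binary.Base using (ℕᵇ; 2[1+_]; 1+[2_]; fromℕ) renaming (zero to 0ᵇ; toℕ to toℕᵇ)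
open import Data.Nat.Binary.Properties using (toℕ-fromℕ)
open import Data.Nat.Properties
open import Data.Product.Base using (Σ-syntax; ∃; ∃₂; ∃-syntax; _×_; _,_; proj₁; proj₂; uncurry)
open import Data.Sum.Base using (_⊎_; inj₁; inj₂; [_,_]′; map₂)
open import Data.Unit.Base using (⊤; tt)
open import Data.Vec.Base using (Vec; []; _∷_)
open import Data.Vec.Membership.Propositional using () renaming (_∈_ to _∈ᵥ_; _∉_ to _∉ᵥ_)
open import Data.Vec.Relation.Binary.Pointwise.Inductive as Pointwise using (Pointwise; []; _∷_)
import Data.Vec.Relation.Unary.Any as VAny
open import Function.Base using (_∘_; id; const)
open import Relation.Binary.PropositionalEquality
  using (_≡_; _≢_; refl; sym; trans; cong; cong₂; subst)
open import Relation.Nullary using (¬_; Dec; yes; no; contradiction)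
open import Relation.Nullary.Decidable using (map′; _×-dec_; _⊎-dec_; _→-dec_; ¬?; decidable-stable)
open import Relation.Nullary.Reflects
open import Relation.Unary using (Decidable)

-- Polynomial bounds

-- The obstacle is that `n ^ k` does not bound the values in the input: `τ` is unrelated to it, and
-- for `n = 1` so is `k`. Hence no program may walk through a numeral unless something else limits
-- the walk. The comparison with `τ` is limited by a unary counter. The number `k` is expanded to
-- unary only if `s ≢ t`, because then `n ≥ 2` and `k ≤ 2 ^ k ≤ n ^ k`; if `s ≡ t`, Facilitator has
-- already won. On the side of the game, finiteness makes every `Win i` decidable, so both
-- strategies can be computed from decisions of membership. Each player recovers the number of
-- completed steps from the length of the history and thereby knows how many steps remain.

infix 4 _≼_
-- The base `2 + μ a` is at least 2 even where `μ` vanishes, so constant factors and sums are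
-- absorbed by raising the exponent; a degree alone then describes a polynomial bound.
record _≼_ {A : Set} (f μ : A → ℕ) : Set where
  constructor within
  field
    degree : ℕ
    bound  : ∀ a → f a ≤ (2 + μ a) ^ degree
open _≼_

n≤2^n : ∀ n → n ≤ 2 ^ n
n≤2^n zero    = z≤n
n≤2^n (suc n) = +-mono-≤ (m^n>0 2 n) (≤-trans (n≤2^n n) (m≤m+n _ 0))

module _ {A : Set} {μ : A → ℕ} where

  ≼-mono : {f g : A → ℕ} → (∀ a → f a ≤ g a) → g ≼ μ → f ≼ μ
  ≼-mono f≤g (within d b) = within d λ a → ≤-trans (f≤g a) (b a)

  ≼-const : ∀ c → (λ _ → c) ≼ μ
  ≼-const c = within c λ a → ≤-trans (n≤2^n c) (^-monoˡ-≤ c (m≤m+n 2 (μ a)))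

  ≼-refl : μ ≼ μ
  ≼-refl = within 1 λ a → ≤-trans (m≤n+m (μ a) 2) (m≤m*n (2 + μ a) 1)

  ≼-+ : {f g : A → ℕ} → f ≼ μ → g ≼ μ → (λ a → f a + g a) ≼ μ
  ≼-+ {f} {g} (within d b) (within e b′) = within (suc (d + e)) λ a → let B = 2 + μ a in begin
    f a + g a                   ≤⟨ +-mono-≤ (b a) (b′ a) ⟩
    B ^ d + B ^ e               ≤⟨ +-mono-≤ (^-monoʳ-≤ B (m≤m+n d e)) (^-monoʳ-≤ B (m≤n+m e d)) ⟩
    B ^ (d + e) + B ^ (d + e)   ≡⟨ cong (B ^ (d + e) +_) (+-identityʳ _) ⟨
    2 * B ^ (d + e)             ≤⟨ *-monoˡ-≤ (B ^ (d + e)) (m≤m+n 2 (μ a)) ⟩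
    B ^ suc (d + e)             ∎
    where open ≤-Reasoning

  ≼-* : {f g : A → ℕ} → f ≼ μ → g ≼ μ → (λ a → f a * g a) ≼ μ
  ≼-* {f} {g} (within d b) (within e b′) = within (d + e) λ a → ≤-trans (*-mono-≤ (b a) (b′ a))
    (≤-reflexive (sym (^-distribˡ-+-* (2 + μ a) d e)))

  ≼-^ : {f : A → ℕ} → f ≼ μ → ∀ e → (λ a → f a ^ e) ≼ μ
  ≼-^ (within d b) e = within (d * e) λ a → ≤-trans (^-monoˡ-≤ e (b a)) (≤-reflexive (^-*-assoc _ d e))

  ≼-∘ : {B : Set} {f ν : B → ℕ} {h : A → B} → f ≼ ν → ν ∘ h ≼ μ → f ∘ h ≼ μ
  ≼-∘ {h = h} (within d b) ν∘h≼μ = ≼-mono (b ∘ h) (≼-^ (≼-+ (≼-const 2) ν∘h≼μ) d)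

-- Encoded data types and their sizes

infixl 6 _⊗_
-- The last argument of base is a measure of size that need not be the size of the encoding.
data Ty : Set₁ where
  base : (C : Set) → (C → Tree) → (C → ℕ) → Ty
  _⊗_  : Ty → Ty → Ty
  list : Ty → Ty

⟦_⟧ : Ty → Set
⟦ base C _ _ ⟧ = C
⟦ A ⊗ B ⟧      = ⟦ A ⟧ × ⟦ B ⟧
⟦ list A ⟧     = List ⟦ A ⟧

enc : ∀ A → ⟦ A ⟧ → Tree
enc (base _ e _) a        = e a
enc (A ⊗ B)      (a , b)  = enc A a ∙ enc B b
enc (list A)     []       = nil
enc (list A)     (a ∷ as) = enc A a ∙ enc (list A) as

-- Each list entry counts at least 1, even if it has size 0 like a boolean, so that `size` bounds
-- the number of iterations of a loop over the list.
size : ∀ A → ⟦ A ⟧ → ℕ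
size (base _ _ μ) a        = μ a
size (A ⊗ B)      (a , b)  = size A a + size B b
size (list A)     []       = 0
size (list A)     (a ∷ as) = suc (size A a) + size (list A) as

length≤size : ∀ A as → length as ≤ size (list A) as
length≤size A []       = z≤n
length≤size A (a ∷ as) = s≤s (≤-trans (length≤size A as) (m≤n+m _ (size A a)))

-- Programs of polynomial running time

-- Stores are functions, hence compared pointwise; code at the variable x
-- uses the variables from x on as its workspace.
_≈[_]_ : Store → Var → Store → Set
ρ ≈[ x ] ρ′ = ∀ y → y < x → ρ′ y ≡ ρ y

Runs : Program → Store → ℕ → (Store → Set) → Set
Runs P ρ m Q = ∃[ m′ ] ∃[ ρ′ ] ⟨ P , ρ ⟩⇓[ m′ ] ρ′ × m′ ≤ m × Q ρ′

-- Besides the time, the size of the output must be polynomial: in a composition the second program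
-- is charged in terms of the intermediate value.
record _⇒_ (A B : Ty) : Set where
  field
    fun   : ⟦ A ⟧ → ⟦ B ⟧
    code  : Var → Program
    time  : ⟦ A ⟧ → ℕ
    time≼ : time ≼ size A
    size≼ : size B ∘ fun ≼ size A
    runs  : ∀ x ρ a → ρ x ≡ enc A a →
            Runs (code x) ρ (time a) λ ρ′ → ρ′ x ≡ enc B (fun a) × (ρ ≈[ x ] ρ′)
open _⇒_
infix 3 _⇒_

≡ᵇ-refl : ∀ x → (x ≡ᵇ x) ≡ true
≡ᵇ-refl zero    = refl
≡ᵇ-refl (suc x) = ≡ᵇ-refl x

≢⇒≡ᵇ-false : ∀ {x y} → x ≢ y → (x ≡ᵇ y) ≡ false
≢⇒≡ᵇ-false {x} {y} x≢y with x ≡ᵇ y in eq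
... | false = refl
... | true  = ⊥-elim (x≢y (≡ᵇ⇒≡ x y (subst T (sym eq) tt)))

update-same : ∀ ρ x a → (ρ [ x ↦ a ]) x ≡ a
update-same ρ x a rewrite ≡ᵇ-refl x = refl

update-other : ∀ ρ {x y} a → x ≢ y → (ρ [ x ↦ a ]) y ≡ ρ y
update-other ρ a x≢y rewrite ≢⇒≡ᵇ-false x≢y = refl

update-below : ∀ ρ {x} a → ρ ≈[ x ] (ρ [ x ↦ a ])
update-below ρ a y y<x = update-other ρ a (>⇒≢ y<x)

Assigned : Var → Tree → Store → Store → Set
Assigned x a ρ ρ′ = ρ′ x ≡ a × (ρ ≈[ x ] ρ′) × (∀ y → x ≢ y → ρ′ y ≡ ρ y)

runs-assign : ∀ {x e ρ a} → eval e ρ ≡ a → Runs (x ≔ e) ρ (1 + cost e) (Assigned x a ρ)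
runs-assign {x} {e} {ρ} eq =
  _ , _ , assign , ≤-refl ,
  trans (update-same ρ x _) eq , update-below ρ _ , λ y → update-other ρ _

runs-seq : ∀ {P P′ ρ m m′ Q Q′} → Runs P ρ m Q → (∀ ρ′ → Q ρ′ → Runs P′ ρ′ m′ Q′) →
           Runs (P ⨾ P′) ρ (m + m′) Q′
runs-seq (_ , _ , d , le , q) k with k _ q
... | _ , _ , d′ , le′ , q′ = _ , _ , seq d d′ , +-mono-≤ le le′ , q′

runs-weaken : ∀ {P ρ m m′ Q Q′} → Runs P ρ m Q → m ≤ m′ → (∀ ρ′ → Q ρ′ → Q′ ρ′) → Runs P ρ m′ Q′
runs-weaken (_ , _ , d , le , q) m≤m′ f = _ , _ , d , ≤-trans le m≤m′ , f _ q

nil≢∙ : ∀ {a b c} → c ≡ a ∙ b → c ≢ nil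
nil≢∙ refl ()

prim : ∀ {A B} (f : ⟦ A ⟧ → ⟦ B ⟧) (e : Var → Expr) c →
       (∀ x → cost (e x) ≤ c) →
       (∀ x ρ a → ρ x ≡ enc A a → eval (e x) ρ ≡ enc B (f a)) →
       size B ∘ f ≼ size A → A ⇒ B
prim f e c e≤c e≡ f≼ = record
  { fun   = f
  ; code  = λ x → x ≔ e x
  ; time  = λ _ → 1 + c
  ; time≼ = ≼-const _
  ; size≼ = f≼
  ; runs  = λ x ρ a ρx≡ → runs-weaken
      (runs-assign (e≡ x ρ a ρx≡))
      (s≤s (e≤c x)) λ { _ (at , below , _) → at , below }
  }

-- Replaces the function that falls out of the combinators by the one meant, so that later
-- correctness proofs compute with the latter.
withFun : ∀ {A B} (f : A ⇒ B) (g : ⟦ A ⟧ → ⟦ B ⟧) → (∀ a → fun f a ≡ g a) → A ⇒ B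
withFun {A} {B} f g eq = record
  { fun   = g
  ; code  = code f
  ; time  = time f
  ; time≼ = time≼ f
  ; size≼ = ≼-mono (λ a → ≤-reflexive (cong (size B) (sym (eq a)))) (size≼ f)
  ; runs  = λ x ρ a ρx≡ → runs-weaken (runs f x ρ a ρx≡) ≤-refl
      λ { _ (at , below) → trans at (cong (enc B) (eq a)) , below }
  }

-- A change of type that costs nothing, since the tree stays the same: the pair of an element and a
-- list already is the extended list, and a unary number already is a list of units.
recode : ∀ {A B C} (f : A ⇒ B) (g : ⟦ B ⟧ → ⟦ C ⟧) → (∀ b → enc B b ≡ enc C (g b)) →
         size C ∘ g ∘ fun f ≼ size A → A ⇒ C
recode {A} {B} {C} f g eq g≼ = record
  { fun   = g ∘ fun f
  ; code  = code f
  ; time  = time f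
  ; time≼ = time≼ f
  ; size≼ = g≼
  ; runs  = λ x ρ a ρx≡ → runs-weaken (runs f x ρ a ρx≡) ≤-refl
      λ { _ (at , below) → trans at (eq _) , below }
  }

infixr 9 _⊙_
_⊙_ : ∀ {A B C} → B ⇒ C → A ⇒ B → A ⇒ C
g ⊙ f = record
  { fun   = fun g ∘ fun f
  ; code  = λ x → code f x ⨾ code g x
  ; time  = λ a → time f a + time g (fun f a)
  ; time≼ = ≼-+ (time≼ f) (≼-∘ (time≼ g) (size≼ f))
  ; size≼ = ≼-∘ (size≼ g) (size≼ f)
  ; runs  = λ x ρ a ρx≡ → runs-seq (runs f x ρ a ρx≡) λ { ρ′ (at , below) →
      runs-weaken (runs g x ρ′ _ at) ≤-refl λ { _ (at′ , below′) →
        at′ , λ _ lt → trans (below′ _ lt) (below _ lt) } }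
  }

⟨_,_⟩ : ∀ {A B C} → A ⇒ B → A ⇒ C → A ⇒ B ⊗ C
⟨_,_⟩ {A} {B} {C} f g = record
  { fun   = λ a → fun f a , fun g a
  ; code  = λ x → (1 + x ≔ var x) ⨾ code f (1 + x) ⨾ (2 + x ≔ var x) ⨾ code g (2 + x)
                  ⨾ (x ≔ cons (var (1 + x)) (var (2 + x)))
  ; time  = λ a → 2 + (time f a + (2 + (time g a + 4)))
  ; time≼ = ≼-+ (≼-const 2) (≼-+ (time≼ f) (≼-+ (≼-const 2) (≼-+ (time≼ g) (≼-const 4))))
  ; size≼ = ≼-+ (size≼ f) (size≼ g)
  ; runs  = λ x ρ a ρx≡ →
      runs-seq (runs-assign ρx≡) λ { ρ₁ (at₁ , below₁ , _) →
      runs-seq (runs f (1 + x) ρ₁ a at₁) λ { ρ₂ (at₂ , below₂) →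
      runs-seq (runs-assign refl) λ { ρ₃ (at₃ , below₃ , _) →
      runs-seq (runs g (2 + x) ρ₃ a (trans at₃ (trans (below₂ _ ≤-refl) (trans (below₁ _ ≤-refl) ρx≡))))
        λ { ρ₄ (at₄ , below₄) →
      runs-weaken (runs-assign refl) ≤-refl λ { ρ₅ (at₅ , below₅ , _) →
        trans at₅ (cong₂ _∙_ (trans (below₄ _ ≤-refl) (trans (below₃ _ ≤-refl) at₂)) at₄)
        , λ _ lt → let lt₁ = m≤n⇒m≤1+n lt; lt₂ = m≤n⇒m≤1+n lt₁ in
          trans (below₅ _ lt) (trans (below₄ _ lt₂) (trans (below₃ _ lt₂) (trans (below₂ _ lt₁) (below₁ _ lt₁)))) } } } } }
  }

-- Pattern matching on nil against a pair, the only test that the language offers. Lists, booleans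
-- and numerals are all taken apart in this way.
record View (S X Y : Ty) : Set where
  field
    uncons      : ⟦ S ⟧ → Maybe (⟦ X ⟧ × ⟦ Y ⟧)
    enc-uncons  : ∀ s → enc S s ≡ maybe (λ (x , y) → enc X x ∙ enc Y y) nil (uncons s)
    size-uncons : ∀ s {x y} → uncons s ≡ just (x , y) → size X x + size Y y ≤ size S s

module _ {A B S X Y : Ty} (view : View S X Y) (s : A ⇒ S) (n : A ⇒ B) (c : A ⊗ X ⊗ Y ⇒ B) where
  open View view

  private
    branch : ⟦ A ⟧ → Maybe (⟦ X ⟧ × ⟦ Y ⟧) → ⟦ B ⟧
    branch a = maybe (λ (x , y) → fun c ((a , x) , y)) (fun n a)

    branchTime : ⟦ A ⟧ → Maybe (⟦ X ⟧ × ⟦ Y ⟧) → ℕ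
    branchTime a = maybe (λ (x , y) → 8 + time c ((a , x) , y)) (time n a)

    -- `h₁` depends on components that exist in one case only, so it is not a function of `a`. Its
    -- polynomial is instead evaluated at `size A a + size S (fun s a)`, which by `size-uncons`
    -- bounds the size of the whole argument.
    bound-by-case : ∀ {h : ⟦ A ⟧ → Maybe (⟦ X ⟧ × ⟦ Y ⟧) → ℕ} {h₀ : ⟦ A ⟧ → ℕ} {h₁ : ⟦ A ⊗ X ⊗ Y ⟧ → ℕ} →
                    (∀ a → h a nothing ≤ h₀ a) → (∀ a x y → h a (just (x , y)) ≤ h₁ ((a , x) , y)) →
                    h₀ ≼ size A → h₁ ≼ size (A ⊗ X ⊗ Y) →
                    (λ a → h a (uncons (fun s a))) ≼ size A
    bound-by-case {h} {h₀} {h₁} h≤h₀ h≤h₁ h₀≼ (within d b) =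
      ≼-mono le (≼-+ h₀≼ (≼-^ (≼-+ (≼-const 2) (≼-+ ≼-refl (size≼ s))) d))
      where
      le : ∀ a → h a (uncons (fun s a)) ≤ h₀ a + (2 + (size A a + size S (fun s a))) ^ d
      le a with uncons (fun s a) in eq
      ... | nothing      = ≤-trans (h≤h₀ a) (m≤m+n _ _)
      ... | just (x , y) = ≤-trans (≤-trans (h≤h₁ a x y) (≤-trans (b _) (^-monoˡ-≤ d (+-monoʳ-≤ 2
                             (≤-trans (≤-reflexive (+-assoc (size A a) _ _)) (+-monoʳ-≤ (size A a) (size-uncons _ eq)))))))
                             (m≤n+m _ (h₀ a))

    branching : Var → Program
    branching x = ifte (var (1 + x))
      ((x ≔ cons (cons (var x) (hd (var (1 + x)))) (tl (var (1 + x)))) ⨾ code c x)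
      (code n x)

  case : A ⇒ B
  case = record
    { fun   = λ a → branch a (uncons (fun s a))
    ; code  = λ x → (1 + x ≔ var x) ⨾ code s (1 + x) ⨾ branching x
    ; time  = λ a → 2 + (time s a + (2 + branchTime a (uncons (fun s a))))
    ; time≼ = ≼-+ (≼-const 2) (≼-+ (time≼ s) (≼-+ (≼-const 2)
                (bound-by-case {h = branchTime} (λ _ → ≤-refl) (λ _ _ _ → ≤-refl) (time≼ n) (≼-+ (≼-const 8) (time≼ c)))))
    ; size≼ = bound-by-case {h = λ a v → size B (branch a v)} (λ _ → ≤-refl) (λ _ _ _ → ≤-refl) (size≼ n) (size≼ c)
    ; runs  = λ x ρ a ρx≡ →
        runs-seq (runs-assign ρx≡) λ { ρ₁ (at₁ , below₁ , _) →
        runs-seq (runs s (1 + x) ρ₁ a at₁) λ { ρ₂ (at₂ , below₂) →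
        runs-weaken (branching-runs x ρ₂ a (uncons (fun s a)) (trans (below₂ _ ≤-refl) (trans (below₁ _ ≤-refl) ρx≡))
                       (trans at₂ (enc-uncons _))) ≤-refl
          λ { _ (at₃ , below₃) → at₃ , λ _ lt →
            trans (below₃ _ lt) (trans (below₂ _ (m≤n⇒m≤1+n lt)) (below₁ _ (m≤n⇒m≤1+n lt))) } } }
    }
    where
    branching-runs : ∀ x ρ a v → ρ x ≡ enc A a → ρ (1 + x) ≡ maybe (λ (x , y) → enc X x ∙ enc Y y) nil v →
                     Runs (branching x) ρ (2 + branchTime a v) λ ρ′ → ρ′ x ≡ enc B (branch a v) × (ρ ≈[ x ] ρ′)
    branching-runs x ρ a nothing ρx≡ ρsx≡ with runs n x ρ a ρx≡
    ... | _ , _ , d , le , q = _ , _ , ifte-false ρsx≡ d , s≤s (s≤s le) , q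
    branching-runs x ρ a (just (y , z)) ρx≡ ρsx≡
      with runs-seq {m′ = time c ((a , y) , z)} {Q′ = λ ρ′ → ρ′ x ≡ enc B (branch a (just (y , z))) × (ρ ≈[ x ] ρ′)}
             (runs-assign (cong₂ _∙_ (cong₂ _∙_ ρx≡ (cong left ρsx≡)) (cong right ρsx≡)))
             (λ { ρ₁ (at₁ , below₁ , _) → runs-weaken (runs c x ρ₁ ((a , y) , z) at₁) ≤-refl
                  λ { _ (at₂ , below₂) → at₂ , λ _ lt → trans (below₂ _ lt) (below₁ _ lt) } })
    ... | _ , _ , d , le , q = _ , _ , ifte-true (nil≢∙ ρsx≡) d , s≤s (s≤s le) , q

module _ {A B X : Ty} (init : A ⇒ B) (xs : A ⇒ list X) (step : A ⊗ B ⊗ X ⇒ B) where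

  private
    F : ⟦ A ⟧ → ⟦ B ⟧ → ⟦ X ⟧ → ⟦ B ⟧
    F a b y = fun step ((a , b) , y)

  -- Iterating a step of polynomial cost stays polynomial only because h bounds all intermediate accumulators.
  fold : {h : ⟦ A ⟧ → ℕ} → h ≼ size A →
         (∀ a ys zs → fun xs a ≡ ys ++ zs → size B (foldl (F a) (fun init a) ys) ≤ h a) → A ⇒ B
  fold {h} h≼ h-bound = record
    { fun   = λ a → foldl (F a) (fun init a) (fun xs a)
    ; code  = λ x → (1 + x ≔ var x) ⨾ code init (1 + x) ⨾ (2 + x ≔ var x) ⨾ code xs (2 + x)
                    ⨾ while (var (2 + x)) (body x) ⨾ (x ≔ var (1 + x))
    ; time  = λ a → 2 + (time init a + (2 + (time xs a + (loopTime a (length (fun xs a)) + 2))))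
    ; time≼ = ≼-+ (≼-const 2) (≼-+ (time≼ init) (≼-+ (≼-const 2) (≼-+ (time≼ xs) (≼-+
                (≼-+ (≼-const 2) (≼-* (≼-mono (λ a → length≤size X (fun xs a)) (size≼ xs))
                  (≼-+ (≼-const _) (≼-^ (≼-+ (≼-const 2) (≼-+ (≼-+ ≼-refl h≼) (size≼ xs))) (degree (time≼ step))))))
                (≼-const 2)))))
    ; size≼ = ≼-mono (λ a → h-bound a (fun xs a) [] (sym (++-identityʳ _))) h≼
    ; runs  = λ x ρ a ρx≡ →
        runs-seq (runs-assign ρx≡) λ { ρ₁ (at₁ , below₁ , _) →
        runs-seq (runs init (1 + x) ρ₁ a at₁) λ { ρ₂ (at₂ , below₂) →
        runs-seq (runs-assign refl) λ { ρ₃ (at₃ , below₃ , _) →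
        let ρ₂x≡ = trans (below₂ _ ≤-refl) (trans (below₁ _ ≤-refl) ρx≡) in
        runs-seq (runs xs (2 + x) ρ₃ a (trans at₃ ρ₂x≡)) λ { ρ₄ (at₄ , below₄) →
        runs-seq (loop x a [] (fun xs a) refl ρ₄
                   (trans (below₄ _ (s≤s (n≤1+n x))) (trans (below₃ _ (s≤s (n≤1+n x))) ρ₂x≡))
                   (trans (below₄ _ ≤-refl) (trans (below₃ _ ≤-refl) at₂)) at₄) λ { ρ₅ (at₅ , below₅) →
        runs-weaken (runs-assign refl) ≤-refl λ { ρ₆ (at₆ , below₆ , _) →
          trans at₆ at₅ , λ _ lt → let lt₁ = m≤n⇒m≤1+n lt; lt₂ = m≤n⇒m≤1+n lt₁ in
          trans (below₆ _ lt) (trans (below₅ _ lt₁) (trans (below₄ _ lt₂) (trans (below₃ _ lt₂) (trans (below₂ _ lt₁) (below₁ _ lt₁))))) } } } } } }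
    }
    where
    body : Var → Program
    body x = (3 + x ≔ cons (cons (var x) (var (1 + x))) (hd (var (2 + x)))) ⨾ code step (3 + x)
             ⨾ (1 + x ≔ var (3 + x)) ⨾ (2 + x ≔ tl (var (2 + x)))

    stepTime : ⟦ A ⟧ → ℕ
    stepTime a = (2 + (size A a + h a + size (list X) (fun xs a))) ^ degree (time≼ step)

    -- Per round: 2 for the test, 7 for assembling the argument of `step`, and 2 + 3 for storing the
    -- result and advancing the list. The leading 2 is the final test.
    loopTime : ⟦ A ⟧ → ℕ → ℕ
    loopTime a l = 2 + l * (14 + stepTime a)

    ∈-size : ∀ ys {y zs} → size X y ≤ size (list X) (ys ++ y ∷ zs)
    ∈-size []       {y} {zs} = ≤-trans (n≤1+n _) (m≤m+n (suc (size X y)) _)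
    ∈-size (y ∷ ys) = ≤-trans (∈-size ys) (m≤n+m _ (suc (size X y)))

    -- Remembering the processed prefix `ys` presents every accumulator as a fold over a prefix,
    -- which is where `h-bound` applies.
    loop : ∀ x a ys zs → fun xs a ≡ ys ++ zs → ∀ ρ → ρ x ≡ enc A a →
           ρ (1 + x) ≡ enc B (foldl (F a) (fun init a) ys) → ρ (2 + x) ≡ enc (list X) zs →
           Runs (while (var (2 + x)) (body x)) ρ (loopTime a (length zs))
             λ ρ′ → ρ′ (1 + x) ≡ enc B (foldl (F a) (fun init a) (fun xs a)) × (ρ ≈[ 1 + x ] ρ′)
    loop x a ys [] eq ρ _ ρ₁≡ ρ₂≡ =
      _ , _ , while-done ρ₂≡ , ≤-refl ,
      trans ρ₁≡ (cong (λ v → enc B (foldl (F a) (fun init a) v)) (trans (sym (++-identityʳ ys)) (sym eq))) , λ _ _ → refl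
    loop x a ys (z ∷ zs) eq ρ ρ₀≡ ρ₁≡ ρ₂≡ = go
      where
      b = foldl (F a) (fun init a) ys

      body-runs : Runs (body x) ρ (7 + (stepTime a + (2 + 3))) λ ρ′ →
        ρ′ (1 + x) ≡ enc B (F a b z) × ρ′ (2 + x) ≡ enc (list X) zs × (ρ ≈[ 1 + x ] ρ′)
      body-runs =
        runs-seq (runs-assign (cong₂ _∙_ (cong₂ _∙_ ρ₀≡ ρ₁≡) (cong left ρ₂≡))) λ { ρ₁ (at₁ , below₁ , _) →
        runs-seq (runs-weaken (runs step (3 + x) ρ₁ ((a , b) , z) at₁)
          (≤-trans (bound (time≼ step) ((a , b) , z)) (^-monoˡ-≤ (degree (time≼ step)) (+-monoʳ-≤ 2
            (+-mono-≤ (+-monoʳ-≤ (size A a) (h-bound a ys (z ∷ zs) eq))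
              (≤-trans (∈-size ys) (≤-reflexive (cong (size (list X)) (sym eq)))))))) λ _ q → q) λ { ρ₂ (at₂ , below₂) →
        runs-seq (runs-assign at₂) λ { ρ₃ (at₃ , below₃ , other₃) →
        runs-weaken (runs-assign refl) ≤-refl λ { ρ₄ (at₄ , below₄ , _) →
          trans (below₄ _ ≤-refl) at₃
          , trans at₄ (cong right (trans (other₃ _ (<⇒≢ ≤-refl)) (trans (below₂ _ ≤-refl) (trans (below₁ _ ≤-refl) ρ₂≡))))
          , λ _ lt → let lt₁ = m≤n⇒m≤1+n lt; lt₂ = m≤n⇒m≤1+n lt₁ in
            trans (below₄ _ lt₁) (trans (below₃ _ lt) (trans (below₂ _ lt₂) (below₁ _ lt₂))) } } } }

      go : Runs (while (var (2 + x)) (body x)) ρ (loopTime a (length (z ∷ zs)))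
             λ ρ′ → ρ′ (1 + x) ≡ enc B (foldl (F a) (fun init a) (fun xs a)) × (ρ ≈[ 1 + x ] ρ′)
      go with body-runs
      ... | m₁ , ρ₁ , d₁ , le₁ , p₁ , p₂ , below₁
        with loop x a (ys List.∷ʳ z) zs (trans eq (sym (++-assoc ys (z ∷ []) zs))) ρ₁ (trans (below₁ _ ≤-refl) ρ₀≡)
               (trans p₁ (cong (enc B) (sym (foldl-++ (F a) (fun init a) ys (z ∷ []))))) p₂
      ... | m₂ , ρ₂ , d₂ , le₂ , q , below₂ =
        _ , _ , while-true (nil≢∙ ρ₂≡) d₁ d₂ , total , q , λ _ lt → trans (below₂ _ lt) (below₁ _ lt)
        where
        open ≤-Reasoning
        total : 2 + m₁ + m₂ ≤ loopTime a (length (z ∷ zs))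
        total = begin
          2 + m₁ + m₂ ≤⟨ +-mono-≤ (+-monoʳ-≤ 2 le₁) le₂ ⟩
          9 + (stepTime a + 5) + (2 + length zs * (14 + stepTime a))
            ≡⟨ cong (λ v → 9 + v + (2 + length zs * (14 + stepTime a))) (+-comm (stepTime a) 5) ⟩
          14 + stepTime a + (2 + length zs * (14 + stepTime a)) ≡⟨ +-comm (14 + stepTime a) _ ⟩
          2 + length zs * (14 + stepTime a) + (14 + stepTime a) ≡⟨ cong (2 +_) (+-comm (length zs * (14 + stepTime a)) _) ⟩
          loopTime a (length (z ∷ zs)) ∎

-- Booleans, unary numbers and lists

bool unit nat : Ty
bool = base Bool encodeBool λ _ → 0
unit = base ⊤ (λ _ → nil) λ _ → 0
nat  = base ℕ (λ n → encodeList (replicate n nil)) id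

private
  variable
    A B C Γ X Y Z : Ty

idₜ : A ⇒ A
idₜ = prim id var 1 (λ _ → ≤-refl) (λ _ _ _ eq → eq) ≼-refl

fstₜ : A ⊗ B ⇒ A
fstₜ {A} {B} = prim proj₁ (λ x → hd (var x)) 2 (λ _ → ≤-refl) (λ _ _ _ eq → cong left eq)
  (≼-mono (λ (a , b) → m≤m+n (size A a) (size B b)) ≼-refl)

sndₜ : A ⊗ B ⇒ B
sndₜ {A} {B} = prim proj₂ (λ x → tl (var x)) 2 (λ _ → ≤-refl) (λ _ _ _ eq → cong right eq)
  (≼-mono (λ (a , b) → m≤n+m (size B b) (size A a)) ≼-refl)

nilₜ : (b : ⟦ B ⟧) → enc B b ≡ nil → A ⇒ B
nilₜ b eq = prim (λ _ → b) (λ _ → nil) 1 (λ _ → ≤-refl) (λ _ _ _ _ → sym eq) (≼-const _)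

falseₜ trueₜ : A ⇒ bool
falseₜ = nilₜ false refl
trueₜ  = prim (λ _ → true) (λ _ → cons nil nil) 3 (λ _ → ≤-refl) (λ _ _ _ _ → refl) (≼-const 0)

zeroₜ : A ⇒ nat
zeroₜ = nilₜ 0 refl

sucₜ : A ⇒ nat → A ⇒ nat
sucₜ f = recode ⟨ nilₜ {B = unit} tt refl , f ⟩ (suc ∘ proj₂) (λ _ → refl) (≼-+ (≼-const 1) (size≼ f))

[]ₜ : A ⇒ list B
[]ₜ = nilₜ [] refl

infixr 5 _∷ₜ_
_∷ₜ_ : A ⇒ B → A ⇒ list B → A ⇒ list B
f ∷ₜ g = recode ⟨ f , g ⟩ (uncurry _∷_) (λ _ → refl) (≼-+ (≼-+ (≼-const 1) (size≼ f)) (size≼ g))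

replicateₜ : A ⇒ nat → A ⇒ list unit
replicateₜ f = recode f (λ n → replicate n tt) enc≡ (≼-mono (size≤ ∘ fun f) (size≼ f))
  where
  enc≡ : ∀ n → encodeList (replicate n nil) ≡ enc (list unit) (replicate n tt)
  enc≡ zero    = refl
  enc≡ (suc n) = cong (nil ∙_) (enc≡ n)

  size≤ : ∀ n → size (list unit) (replicate n tt) ≤ n
  size≤ zero    = z≤n
  size≤ (suc n) = s≤s (size≤ n)

listView : View (list X) X (list X)
listView {X} = record
  { uncons      = λ { [] → nothing ; (x ∷ xs) → just (x , xs) }
  ; enc-uncons  = λ { [] → refl ; (x ∷ xs) → refl }
  ; size-uncons = λ { (x ∷ xs) refl → n≤1+n _ }
  }

boolView : View bool unit unit
boolView = record
  { uncons      = λ b → if b then just (tt , tt) else nothing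
  ; enc-uncons  = λ { true → refl ; false → refl }
  ; size-uncons = λ _ _ → z≤n
  }

if_then_else_fi : A ⇒ bool → A ⇒ B → A ⇒ B → A ⇒ B
if c then f else g fi =
  withFun (case boolView c g (f ⊙ fstₜ ⊙ fstₜ)) (λ a → if fun c a then fun f a else fun g a) λ a → eq (fun c a)
  where
  eq : ∀ b {D : Set} {x y : D} → maybe (const x) y (if b then just (tt , tt) else nothing) ≡ (if b then x else y)
  eq true  = refl
  eq false = refl

infixr 6 _∧ₜ_
infixr 5 _∨ₜ_
_∧ₜ_ _∨ₜ_ : A ⇒ bool → A ⇒ bool → A ⇒ bool
f ∧ₜ g = withFun (if f then g else falseₜ fi) (λ a → fun f a ∧ fun g a) λ a → eq (fun f a)
  where
  eq : ∀ b {c} → (if b then c else false) ≡ b ∧ c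
  eq true  = refl
  eq false = refl
f ∨ₜ g = withFun (if f then trueₜ else g fi) (λ a → fun f a ∨ fun g a) λ a → eq (fun f a)
  where
  eq : ∀ b {c} → (if b then true else c) ≡ b ∨ c
  eq true  = refl
  eq false = refl

notₜ : A ⇒ bool → A ⇒ bool
notₜ f = withFun (if f then falseₜ else trueₜ fi) (not ∘ fun f) λ a → eq (fun f a)
  where
  eq : ∀ b → (if b then false else true) ≡ not b
  eq true  = refl
  eq false = refl

-- Loops whose accumulators grow slowly

size-∈ : ∀ X {xs : List ⟦ X ⟧} {x} → x ∈ xs → size X x ≤ size (list X) xs
size-∈ X {x = x} (here refl) = ≤-trans (n≤1+n _) (m≤m+n (suc (size X x)) _)
size-∈ X {y ∷ _} (there x∈)  = ≤-trans (size-∈ X x∈) (m≤n+m _ (suc (size X y)))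

size-foldl : ∀ (B : Ty) {C : Set} {F : ⟦ B ⟧ → C → ⟦ B ⟧} h (ys : List C) →
             (∀ b {y} → y ∈ ys → size B (F b y) ≤ size B b + h) →
             ∀ b → size B (foldl F b ys) ≤ size B b + length ys * h
size-foldl B         h []       step b = m≤m+n _ 0
size-foldl B {F = F} h (y ∷ ys) step b = begin
  size B (foldl F (F b y) ys)        ≤⟨ size-foldl B h ys (λ b → step b ∘ there) (F b y) ⟩
  size B (F b y) + length ys * h     ≤⟨ +-monoˡ-≤ (length ys * h) (step b (here refl)) ⟩
  size B b + h + length ys * h       ≡⟨ +-assoc (size B b) h _ ⟩
  size B b + length (y ∷ ys) * h     ∎
  where open ≤-Reasoning

size-++ : ∀ X (ys : List ⟦ X ⟧) zs → size (list X) ys ≤ size (list X) (ys ++ zs)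
size-++ X []       zs = z≤n
size-++ X (y ∷ ys) zs = +-monoʳ-≤ (suc (size X y)) (size-++ X ys zs)

-- If one step adds at most `h a`, whatever the accumulator, then all rounds together add at most
-- the number of rounds times `h a`. Steps that multiply the accumulator do not qualify and use
-- `fold` with a closed form.
fold⁺ : ∀ (init : A ⇒ B) (xs : A ⇒ list X) (step : A ⊗ B ⊗ X ⇒ B) {h : ⟦ A ⟧ → ℕ} → h ≼ size A →
        (∀ a b {x} → x ∈ fun xs a → size B (fun step ((a , b) , x)) ≤ size B b + h a) → A ⇒ B
fold⁺ {A} {B} {X} init xs step {h} h≼ grow =
  fold init xs step (≼-+ (size≼ init) (≼-* (size≼ xs) h≼)) λ a ys zs eq →
    ≤-trans (size-foldl B (h a) ys (λ b y∈ → grow a b (subst (_ ∈_) (sym eq) (∈-++⁺ˡ y∈))) (fun init a))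
      (+-monoʳ-≤ (size B (fun init a)) (*-monoˡ-≤ (h a)
        (≤-trans (length≤size X ys) (subst (λ v → size (list X) ys ≤ size (list X) v) (sym eq) (size-++ X ys zs)))))

anyₜ : Γ ⇒ list X → Γ ⊗ X ⇒ bool → Γ ⇒ bool
anyₜ {Γ} {X} xs p =
  withFun (fold⁺ falseₜ xs (sndₜ ⊙ fstₜ ∨ₜ p ⊙ ⟨ fstₜ ⊙ fstₜ , sndₜ ⟩) (≼-const 0) (λ _ _ _ → z≤n))
    (λ γ → any (λ x → fun p (γ , x)) (fun xs γ)) λ γ → eq γ false (fun xs γ)
  where
  eq : ∀ γ b xs → foldl (λ b x → b ∨ fun p (γ , x)) b xs ≡ b ∨ any (λ x → fun p (γ , x)) xs
  eq γ b []       = sym (∨-identityʳ b)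
  eq γ b (x ∷ xs) = trans (eq γ _ xs) (∨-assoc b _ _)

allₜ : Γ ⇒ list X → Γ ⊗ X ⇒ bool → Γ ⇒ bool
allₜ {Γ} {X} xs p =
  withFun (fold⁺ trueₜ xs (sndₜ ⊙ fstₜ ∧ₜ p ⊙ ⟨ fstₜ ⊙ fstₜ , sndₜ ⟩) (≼-const 0) (λ _ _ _ → z≤n))
    (λ γ → all (λ x → fun p (γ , x)) (fun xs γ)) λ γ → eq γ true (fun xs γ)
  where
  eq : ∀ γ b xs → foldl (λ b x → b ∧ fun p (γ , x)) b xs ≡ b ∧ all (λ x → fun p (γ , x)) xs
  eq γ b []       = sym (∧-identityʳ b)
  eq γ b (x ∷ xs) = trans (eq γ _ xs) (∧-assoc b _ _)

-- The accumulator form matches `fold`. It reverses the order, which is harmless because such lists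
-- stand for sets.
select : ∀ {C : Set} → (C → Bool) → List C → List C → List C
select p = foldl λ acc x → if p x then x ∷ acc else acc

size-select : ∀ X (p : ⟦ X ⟧ → Bool) acc xs →
              size (list X) (select p acc xs) ≤ size (list X) xs + size (list X) acc
size-select X p acc []       = ≤-refl
size-select X p acc (x ∷ xs) with p x
... | true  = ≤-trans (size-select X p (x ∷ acc) xs) (≤-reflexive
                (trans (sym (+-assoc (size (list X) xs) _ _)) (cong (_+ size (list X) acc) (+-comm (size (list X) xs) _))))
... | false = ≤-trans (size-select X p acc xs) (+-monoˡ-≤ (size (list X) acc) (m≤n+m _ (suc (size X x))))

selectₜ : Γ ⇒ list X → Γ ⊗ X ⇒ bool → Γ ⇒ list X
selectₜ {Γ} {X} xs p =
  withFun (fold⁺ []ₜ xs (if p ⊙ ⟨ fstₜ ⊙ fstₜ , sndₜ ⟩ then sndₜ ∷ₜ sndₜ ⊙ fstₜ else sndₜ ⊙ fstₜ fi)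
            (≼-+ (≼-const 1) (size≼ xs)) λ γ acc x∈ → grow (fun p _) acc (size-∈ X x∈))
    (λ γ → select (λ x → fun p (γ , x)) [] (fun xs γ)) λ _ → refl
  where
  grow : ∀ b acc {x n} → size X x ≤ n → size (list X) (if b then x ∷ acc else acc) ≤ size (list X) acc + (1 + n)
  grow true  acc x≤n = ≤-trans (+-monoˡ-≤ _ (s≤s x≤n)) (≤-reflexive (+-comm (suc _) (size (list X) acc)))
  grow false acc x≤n = m≤m+n _ _

productWith : ∀ {C D E : Set} → (C → D → E) → List E → List C → List D → List E
productWith f acc xs ys = foldl (λ acc x → foldl (λ acc y → f x y ∷ acc) acc ys) acc xs

productWithₜ : Γ ⇒ list X → Γ ⇒ list Y → Γ ⊗ X ⊗ Y ⇒ Z → Γ ⇒ list Z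
productWithₜ {Γ} {X} {Y} {Z} xs ys f =
  withFun (fold⁺ []ₜ xs inner (≼-* (size≼ ys) h≼) λ γ acc x∈ →
      ≤-trans (size-foldl (list Z) (h γ) (fun ys γ) (λ acc y∈ → grow γ acc x∈ y∈) acc)
        (+-monoʳ-≤ (size (list Z) acc) (*-monoˡ-≤ (h γ) (length≤size Y (fun ys γ)))))
    (λ γ → productWith (λ x y → fun f ((γ , x) , y)) [] (fun xs γ) (fun ys γ)) λ _ → refl
  where
  d = degree (size≼ f)

  h : ⟦ Γ ⟧ → ℕ
  h γ = 1 + (2 + (size Γ γ + size (list X) (fun xs γ) + size (list Y) (fun ys γ))) ^ d

  h≼ : h ≼ size Γ
  h≼ = ≼-+ (≼-const 1) (≼-^ (≼-+ (≼-const 2) (≼-+ (≼-+ ≼-refl (size≼ xs)) (size≼ ys))) d)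

  grow : ∀ γ acc {x y} → x ∈ fun xs γ → y ∈ fun ys γ →
         size (list Z) (fun f ((γ , x) , y) ∷ acc) ≤ size (list Z) acc + h γ
  grow γ acc x∈ y∈ = ≤-trans (≤-reflexive (+-comm (suc _) (size (list Z) acc)))
    (+-monoʳ-≤ (size (list Z) acc) (s≤s (≤-trans (bound (size≼ f) _)
      (^-monoˡ-≤ d (+-monoʳ-≤ 2 (+-mono-≤ (+-monoʳ-≤ (size Γ γ) (size-∈ X x∈)) (size-∈ Y y∈)))))))

  inner : Γ ⊗ list Z ⊗ X ⇒ list Z
  inner = fold⁺ (sndₜ ⊙ fstₜ) (ys ⊙ fstₜ ⊙ fstₜ) (f ⊙ ⟨ ⟨ fstₜ ⊙ fstₜ ⊙ fstₜ ⊙ fstₜ , sndₜ ⊙ fstₜ ⊙ fstₜ ⟩ , sndₜ ⟩ ∷ₜ sndₜ ⊙ fstₜ)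
    {λ ((γ , acc) , x) → 1 + (2 + (size Γ γ + size X x + size (list Y) (fun ys γ))) ^ d}
    (≼-+ (≼-const 1) (≼-^ (≼-+ (≼-const 2) (≼-+ (≼-+ (size≼ (fstₜ {Γ} ⊙ fstₜ {Γ ⊗ list Z} {X})) (size≼ (sndₜ {Γ ⊗ list Z} {X})))
      (size≼ (ys ⊙ fstₜ {Γ} ⊙ fstₜ {Γ ⊗ list Z} {X})))) d))
    λ ((γ , _) , x) acc y∈ → ≤-trans (≤-reflexive (+-comm (suc _) (size (list Z) acc)))
      (+-monoʳ-≤ (size (list Z) acc) (s≤s (≤-trans (bound (size≼ f) _)
        (^-monoˡ-≤ d (+-monoʳ-≤ 2 (+-monoʳ-≤ (size Γ γ + size X x) (size-∈ Y y∈)))))))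

-- Comparison of lists and unary arithmetic

pairwise : ∀ {C D : Set} → (C → D → Bool) → List C → List D → Bool
pairwise r []       []       = true
pairwise r []       (y ∷ ys) = false
pairwise r (x ∷ xs) []       = false
pairwise r (x ∷ xs) (y ∷ ys) = r x y ∧ pairwise r xs ys

nullₜ : A ⇒ list X → A ⇒ bool
nullₜ xs = withFun (case listView xs trueₜ falseₜ) (null ∘ fun xs) eq
  where
  eq : ∀ a → fun (case listView xs trueₜ falseₜ) a ≡ null (fun xs a)
  eq a with fun xs a
  ... | []    = refl
  ... | _ ∷ _ = refl

pairwiseₜ : Γ ⇒ list X → Γ ⇒ list Y → Γ ⊗ X ⊗ Y ⇒ bool → Γ ⇒ bool
pairwiseₜ {Γ} {X} {Y} xs ys r =
  withFun (nullₜ (sndₜ ⊙ loop) ∧ₜ fstₜ ⊙ loop) (λ γ → pairwise (λ x y → fun r ((γ , x) , y)) (fun xs γ) (fun ys γ))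
    λ γ → eq γ true (fun xs γ) (fun ys γ)
  where
  -- The accumulator is the verdict so far with the unread part of `ys`. If `ys` ends too early, the
  -- state `(false , [])` is never left again; if it is too long, the final `nullₜ` test notices.
  step : Γ ⊗ (bool ⊗ list Y) ⊗ X ⇒ bool ⊗ list Y
  step = case listView (sndₜ ⊙ sndₜ ⊙ fstₜ) ⟨ falseₜ , []ₜ ⟩
    ⟨ fstₜ ⊙ sndₜ ⊙ fstₜ ⊙ fstₜ ⊙ fstₜ
      ∧ₜ r ⊙ ⟨ ⟨ fstₜ ⊙ fstₜ ⊙ fstₜ ⊙ fstₜ , sndₜ ⊙ fstₜ ⊙ fstₜ ⟩ , sndₜ ⊙ fstₜ ⟩ , sndₜ ⟩

  loop : Γ ⇒ bool ⊗ list Y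
  loop = fold⁺ ⟨ trueₜ , ys ⟩ xs step (≼-const 0) grow
    where
    grow : ∀ γ b {x} → x ∈ fun xs γ → size (bool ⊗ list Y) (fun step ((γ , b) , x)) ≤ size (bool ⊗ list Y) b + 0
    grow γ (_ , [])    _ = z≤n
    grow γ (_ , y ∷ ys) _ = ≤-trans (m≤n+m _ (suc (size Y y))) (m≤m+n _ 0)

  run : ⟦ Γ ⟧ → Bool → List ⟦ X ⟧ → List ⟦ Y ⟧ → Bool × List ⟦ Y ⟧
  run γ b xs ys = foldl (λ b x → fun step ((γ , b) , x)) (b , ys) xs

  result : Bool × List ⟦ Y ⟧ → Bool
  result (b , ys) = null ys ∧ b

  stuck : ∀ γ xs → result (run γ false xs []) ≡ false
  stuck γ []       = refl
  stuck γ (x ∷ xs) = stuck γ xs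

  eq : ∀ γ b xs ys → result (run γ b xs ys) ≡ b ∧ pairwise (λ x y → fun r ((γ , x) , y)) xs ys
  eq γ b []       []       = sym (∧-identityʳ b)
  eq γ b []       (y ∷ ys) = sym (∧-zeroʳ b)
  eq γ b (x ∷ xs) []       = trans (stuck γ xs) (sym (∧-zeroʳ b))
  eq γ b (x ∷ xs) (y ∷ ys) = trans (eq γ _ xs ys) (∧-assoc b _ _)

infix 7 _≡ᵇₜ_
-- The language cannot compare trees, so equality of unary numbers is equality of lengths, decided
-- by a pairwise relation that always holds.
_≡ᵇₜ_ : A ⇒ nat → A ⇒ nat → A ⇒ bool
f ≡ᵇₜ g = withFun (pairwiseₜ (replicateₜ f) (replicateₜ g) trueₜ) (λ a → fun f a ≡ᵇ fun g a) λ a → eq (fun f a) (fun g a)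
  where
  eq : ∀ m n → pairwise (λ _ _ → true) (replicate m tt) (replicate n tt) ≡ (m ≡ᵇ n)
  eq zero    zero    = refl
  eq zero    (suc n) = refl
  eq (suc m) zero    = refl
  eq (suc m) (suc n) = eq m n

infixl 8 _+ₜ_
_+ₜ_ : A ⇒ nat → A ⇒ nat → A ⇒ nat
f +ₜ g = withFun (fold⁺ f (replicateₜ g) (sucₜ (sndₜ ⊙ fstₜ)) (≼-const 1) λ _ b _ → ≤-reflexive (+-comm 1 b))
  (λ a → fun f a + fun g a) λ a → eq (fun f a) (fun g a)
  where
  eq : ∀ m n → foldl (λ b _ → suc b) m (replicate n tt) ≡ m + n
  eq m zero    = sym (+-identityʳ m)
  eq m (suc n) = trans (eq (suc m) n) (sym (+-suc m n))

dropₜ : A ⇒ nat → A ⇒ list X → A ⇒ list X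
dropₜ {A} {X} n xs = withFun (fold⁺ xs (replicateₜ n) tailₜ (≼-const 0) grow)
  (λ a → drop (fun n a) (fun xs a)) λ a → eq a (fun n a) (fun xs a)
  where
  tailₜ : A ⊗ list X ⊗ unit ⇒ list X
  tailₜ = case listView (sndₜ ⊙ fstₜ) []ₜ sndₜ

  grow : ∀ a b {x} → x ∈ _ → size (list X) (fun tailₜ ((a , b) , x)) ≤ size (list X) b + 0
  grow a []       _ = z≤n
  grow a (x ∷ xs) _ = ≤-trans (m≤n+m _ (suc (size X x))) (m≤m+n _ 0)

  empty : ∀ a n → foldl (λ b x → fun tailₜ ((a , b) , x)) [] (replicate n tt) ≡ []
  empty a zero    = refl
  empty a (suc n) = empty a n

  eq : ∀ a n xs → foldl (λ b x → fun tailₜ ((a , b) , x)) xs (replicate n tt) ≡ drop n xs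
  eq a zero    xs       = refl
  eq a (suc n) []       = empty a n
  eq a (suc n) (x ∷ xs) = eq a n xs

halfₜ : A ⇒ nat → A ⇒ nat
halfₜ {A} f = withFun (fstₜ ⊙ loop) (λ a → ⌊ fun f a /2⌋) λ a → cong proj₁ (eq 0 (fun f a))
  where
  -- The pair holds both halves of the count, rounded down and up. Incrementing the count makes the
  -- old upper half the new lower one, and the successor of the old lower half the new upper one.
  loop : A ⇒ nat ⊗ nat
  loop = fold⁺ ⟨ zeroₜ , zeroₜ ⟩ (replicateₜ f) ⟨ sndₜ ⊙ sndₜ ⊙ fstₜ , sucₜ (fstₜ ⊙ sndₜ ⊙ fstₜ) ⟩ (≼-const 1)
    λ _ (m , n) _ → ≤-reflexive (trans (+-suc n m) (trans (cong suc (+-comm n m)) (+-comm 1 (m + n))))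

  eq : ∀ m n → foldl (λ (a , b) _ → b , suc a) (⌊ m /2⌋ , ⌈ m /2⌉) (replicate n tt) ≡ (⌊ m + n /2⌋ , ⌈ m + n /2⌉)
  eq m zero    rewrite +-identityʳ m = refl
  eq m (suc n) rewrite +-suc m n = eq (suc m) n

predₜ : A ⇒ nat → A ⇒ nat
predₜ f = prim pred (λ x → tl (var x)) 2 (λ _ → ≤-refl) enc≡ (≼-mono (λ _ → pred[n]≤n) ≼-refl) ⊙ f
  where
  enc≡ : ∀ x ρ n → ρ x ≡ encodeList (replicate n nil) → right (ρ x) ≡ encodeList (replicate (pred n) nil)
  enc≡ x ρ zero    eq = cong right eq
  enc≡ x ρ (suc n) eq = cong right eq

-- The game

length-cartesianProductWith : ∀ {A B C : Set} (f : A → B → C) xs ys →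
                              length (cartesianProductWith f xs ys) ≡ length xs * length ys
length-cartesianProductWith f []       ys = refl
length-cartesianProductWith f (x ∷ xs) ys = trans (length-++ (List.map (f x) ys))
  (cong₂ _+_ (length-map (f x) ys) (length-cartesianProductWith f xs ys))

module _ {A : Set} {xs : List A} (complete : ∀ x → x ∈ xs) where

  any-complete? : ∀ {P : A → Set} → Decidable P → Dec (∃ P)
  any-complete? P? = map′ Any.satisfied (λ (x , px) → lose (complete x) px) (Any.any? P? xs)

  all-complete? : ∀ {P : A → Set} → Decidable P → Dec (∀ x → P x)
  all-complete? P? = map′ (λ ¬∃ x → decidable-stable (P? x) (λ ¬p → ¬∃ (x , ¬p))) (λ ∀p (x , ¬p) → ¬p (∀p x))
    (¬? (any-complete? (¬? ∘ P?)))

-- Counting and the stabilisation of increasing sets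

module _ {A : Set} {P Q : A → Set} (P? : Decidable P) (Q? : Decidable Q) (P⊆Q : ∀ {x} → P x → Q x) where

  length-filter-≤ : ∀ xs → length (filter P? xs) ≤ length (filter Q? xs)
  length-filter-≤ [] = z≤n
  length-filter-≤ (x ∷ xs) with P? x | Q? x
  ... | yes p | yes q = s≤s (length-filter-≤ xs)
  ... | yes p | no ¬q = contradiction (P⊆Q p) ¬q
  ... | no ¬p | yes q = m≤n⇒m≤1+n (length-filter-≤ xs)
  ... | no ¬p | no ¬q = length-filter-≤ xs

  length-filter-< : ∀ {x xs} → x ∈ xs → ¬ P x → Q x → length (filter P? xs) < length (filter Q? xs)
  length-filter-< {x} {_ ∷ xs} (here refl) ¬p q with P? x | Q? x
  ... | yes p | _     = contradiction p ¬p
  ... | no _  | yes _ = s≤s (length-filter-≤ xs)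
  ... | no _  | no ¬q = contradiction q ¬q
  length-filter-< {x} {y ∷ _} (there x∈) ¬p q with P? y | Q? y
  ... | yes p | yes q′ = s≤s (length-filter-< x∈ ¬p q)
  ... | yes p | no ¬q  = contradiction (P⊆Q p) ¬q
  ... | no _  | yes _  = m≤n⇒m≤1+n (length-filter-< x∈ ¬p q)
  ... | no _  | no _   = length-filter-< x∈ ¬p q

module Stabilisation
  {A : Set} {xs : List A} (complete : ∀ x → x ∈ xs)
  (P : ℕ → A → Set) (P? : ∀ i → Decidable (P i))
  (grows : ∀ i {x} → P i x → P (suc i) x)
  (persists : ∀ i → (∀ x → P (suc i) x → P i x) → ∀ x → P (suc (suc i)) x → P (suc i) x) where

  Stable : ℕ → Set
  Stable i = ∀ x → P (suc i) x → P i x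

  -- Every step that is not yet stable gains a listed element, and by `persists` stability is never
  -- lost; so without stability the `i`-th set has at least `i` elements.
  stable-or-many : ∀ i → Stable i ⊎ i ≤ length (filter (P? i) xs)
  stable-or-many zero = inj₂ z≤n
  stable-or-many (suc i) with stable-or-many i
  ... | inj₁ stable = inj₁ (persists i stable)
  ... | inj₂ many with any-complete? complete (λ x → P? (suc i) x ×-dec ¬? (P? i x))
  ...   | yes (x , p , ¬p) = inj₂ (≤-trans (s≤s many) (length-filter-< (P? i) (P? (suc i)) (grows i) (complete x) ¬p p))
  ...   | no ¬∃ = inj₁ (persists i λ x p → decidable-stable (P? i x) λ ¬p → ¬∃ (x , p , ¬p))

  -- In the second case the set already contains every listed element, so nothing can be gained
  -- either.
  stable : Stable (length xs)
  stable with stable-or-many (length xs)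
  ... | inj₁ st   = st
  ... | inj₂ many = λ x _ → decidable-stable (P? _ x) λ ¬p →
    <⇒≱ (filter-notAll (P? (length xs)) xs (lose (complete x) ¬p)) many

  stable-from : ∀ i → Stable (i + length xs)
  stable-from zero    = stable
  stable-from (suc i) = persists _ (stable-from i)

  monotone : ∀ {i j} → i ≤ j → ∀ {x} → P i x → P j x
  monotone i≤j = go (≤⇒≤′ i≤j)
    where
    go : ∀ {i j} → i ≤′ j → ∀ {x} → P i x → P j x
    go ≤′-refl       p = p
    go (≤′-step i≤j) p = grows _ (go i≤j p)

  -- Lifting to the index `i + length xs` first makes every one of the `i` steps downwards a step
  -- between stable sets.
  reached : ∀ i {x} → P i x → P (length xs) x
  reached i p = descend i (monotone (m≤m+n i (length xs)) p)
    where
    descend : ∀ i {x} → P (i + length xs) x → P (length xs) x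
    descend zero    p = p
    descend (suc i) p = descend i (stable-from i _ p)

length-allFin : ∀ n → length (allFin n) ≡ n
length-allFin n = length-tabulate {n = n} id

vectors : ∀ n k → List (Vec (Fin n) k)
vectors n zero    = [] ∷ []
vectors n (suc k) = cartesianProductWith _∷_ (allFin n) (vectors n k)

∈-vectors : ∀ {n k} (v : Vec (Fin n) k) → v ∈ vectors n k
∈-vectors []      = here refl
∈-vectors (x ∷ v) = ∈-cartesianProductWith⁺ _∷_ (∈-allFin x) (∈-vectors v)

length-vectors : ∀ n k → length (vectors n k) ≡ n ^ k
length-vectors n zero    = refl
length-vectors n (suc k) = trans (length-cartesianProductWith _∷_ (allFin n) (vectors n k))
  (cong₂ _*_ (length-allFin n) (length-vectors n k))

-- Winning positions and strategies

module Play {n : ℕ} (G : ConnectedGraph n) (s t : Fin n) (k : ℕ) where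
  open ConnectedGraph G
  open Game G s t k
  open DividerStrategy

  agentMove? : ∀ {m} (opp : Vec V m) u v → Dec (AgentMove opp u v)
  agentMove? opp u v = (v Fin.≟ u) ⊎-dec (T? (adj u v) ×-dec ¬? (VAny.any? (v Fin.≟_) opp))

  positions : List Position
  positions = cartesianProductWith (λ (r , j) → position r j) (cartesianProductWith _,_ (allFin n) (allFin n)) (vectors n k)

  ∈-positions : ∀ p → p ∈ positions
  ∈-positions (position r j d) = ∈-cartesianProductWith⁺ _ (∈-cartesianProductWith⁺ _,_ (∈-allFin r) (∈-allFin j)) (∈-vectors d)

  length-positions : length positions ≡ n * n * n ^ k
  length-positions = trans (length-cartesianProductWith _ (cartesianProductWith _,_ (allFin n) (allFin n)) (vectors n k))
    (cong₂ _*_ (trans (length-cartesianProductWith _,_ (allFin n) (allFin n)) (cong₂ _*_ (length-allFin n) (length-allFin n)))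
      (length-vectors n k))

  -- A meeting brought about by Facilitator's move is noticed only after Divider's reply, which
  -- leaves `r` and `j` in place. The disjunct `R p ≡ J p` makes the sets increase with the index.
  Win : ℕ → Position → Set
  Win zero    p = R p ≡ J p
  Win (suc i) p = R p ≡ J p ⊎
    ∃₂ λ r j → (AgentMove (D p) (R p) r × AgentMove (D p) (J p) j) ×
               (∀ d → Pointwise (AgentMove (r ∷ j ∷ [])) (D p) d → Win i (position r j d))

  win? : ∀ i p → Dec (Win i p)
  win? zero    p = R p Fin.≟ J p
  win? (suc i) p = (R p Fin.≟ J p) ⊎-dec Fin.any? λ r → Fin.any? λ j →
    (agentMove? (D p) (R p) r ×-dec agentMove? (D p) (J p) j) ×-dec
    all-complete? ∈-vectors λ d → (Pointwise.decidable (agentMove? (r ∷ j ∷ [])) (D p) d →-dec win? i (position r j d))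

  met⇒win : ∀ i {p} → R p ≡ J p → Win i p
  met⇒win zero    eq = eq
  met⇒win (suc i) eq = inj₁ eq

  win-mono : ∀ {i j} → (∀ {p} → Win i p → Win j p) → ∀ {p} → Win (suc i) p → Win (suc j) p
  win-mono f = map₂ λ (r , j , legal , w) → r , j , legal , λ d l → f (w d l)

  win-suc : ∀ i {p} → Win i p → Win (suc i) p
  win-suc zero    = inj₁
  win-suc (suc i) = win-mono (win-suc i)

  open Stabilisation ∈-positions Win win? win-suc (λ i st x → win-mono (st _)) public using (stable; monotone; reached)

  WinsAll : ℕ → Set
  WinsAll i = ∀ d → s ∉ᵥ d → t ∉ᵥ d → Win i (position s t d)

  ¬winsAll⇒∃ : ∀ i → ¬ WinsAll i → ∃[ d ] s ∉ᵥ d × t ∉ᵥ d × ¬ Win i (position s t d)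
  ¬winsAll⇒∃ i ¬all = decidable-stable
    (any-complete? ∈-vectors λ d →
      ¬? (VAny.any? (s Fin.≟_) d) ×-dec (¬? (VAny.any? (t Fin.≟_) d) ×-dec ¬? (win? i _)))
    λ ¬∃ → ¬all λ d s∉ t∉ → decidable-stable (win? i _) λ ¬w → ¬∃ (d , s∉ , t∉ , ¬w)

  -- A completed step adds two positions to the history, so the number of steps can be read off it;
  -- this is the only clock available to a strategy.
  rounds : List Position → ℕ
  rounds (_ ∷ _ ∷ h) = suc (rounds h)
  rounds _           = 0

  rounds-play : ∀ σ δ i → rounds (proj₁ (play σ δ i)) ≡ i
  rounds-play σ δ zero    = refl
  rounds-play σ δ (suc i) = cong suc (rounds-play σ δ i)

  module _ (τ : ℕ) where

    -- The decision is passed as an argument so that proofs can split on it. Outside the winning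
    -- case both agents stay, which is always legal.
    advance : ∀ m p → Dec (Win m p) → FacilitatorMove p
    advance (suc m) p (yes (inj₂ (r , j , legal , _))) = (r , j) , legal
    advance _       p _                                = (R p , J p) , inj₁ refl , inj₁ refl

    -- `l` is kept apart from `suc m` because in use it is `τ ∸ rounds h`, which is a successor only
    -- up to a proof.
    advance-wins : ∀ {l m p} (w? : Dec (Win l p)) → l ≡ suc m → Win l p →
                   R p ≡ J p ⊎ (∀ d → Win m (afterDivider (afterFacilitator p (advance l p w?)) d))
    advance-wins (yes (inj₁ eq))              refl w = inj₁ eq
    advance-wins (yes (inj₂ (_ , _ , _ , f))) refl w = inj₂ λ (d , l) → f d l
    advance-wins (no ¬w)                      refl w = contradiction w ¬w

    descend : FacilitatorStrategy
    descend h p = advance (τ ∸ rounds h) p (win? (τ ∸ rounds h) p)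

    winsAll⇒winsWithin : WinsAll τ → FacilitatorWinsWithin τ
    winsAll⇒winsWithin all = descend , λ δ → finish δ (invariant δ τ ≤-refl)
      where
      Met≤ : DividerStrategy → ℕ → Set
      Met≤ δ i = ∃[ i′ ] i′ ≤ i × MetAfter descend δ i′

      -- The index falls by one with each step unless the agents have met; at `i = τ` it is 0, where
      -- `Win` means that they meet.
      invariant : ∀ δ i → i ≤ τ → Met≤ δ i ⊎ Win (τ ∸ i) (proj₂ (play descend δ i))
      invariant δ zero    _   = inj₂ (all (placement δ) (avoids-s δ) (avoids-t δ))
      invariant δ (suc i) i<τ with invariant δ i (<⇒≤ i<τ)
      ... | inj₁ (i′ , i′≤i , met) = inj₁ (i′ , m≤n⇒m≤1+n i′≤i , met)
      ... | inj₂ w with play descend δ i in eq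
      ...   | h , p with advance-wins (win? (τ ∸ rounds h) p)
                          (trans (cong (τ ∸_) rounds≡)
                            (trans (sym (suc-pred (τ ∸ i) ⦃ τ∸i≢0 ⦄)) (cong suc (pred[m∸n]≡m∸[1+n] τ i))))
                          (subst (λ v → Win (τ ∸ v) p) (sym rounds≡) w)
        where
        rounds≡ : rounds h ≡ i
        rounds≡ = trans (cong (rounds ∘ proj₁) (sym eq)) (rounds-play descend δ i)

        τ∸i≢0 : NonZero (τ ∸ i)
        τ∸i≢0 = >-nonZero (m<n⇒0<n∸m i<τ)
      ...     | inj₁ met = inj₁ (i , n≤1+n i , subst (λ (_ , p) → R p ≡ J p) (sym eq) met)
      ...     | inj₂ f   = inj₂ (f (respond δ (p ∷ h) (afterFacilitator p (descend h p))))

      finish : ∀ δ → Met≤ δ τ ⊎ Win (τ ∸ τ) (proj₂ (play descend δ τ)) → Met≤ δ τ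
      finish δ (inj₁ met) = met
      finish δ (inj₂ w)   = τ , ≤-refl , subst (λ v → Win v (proj₂ (play descend δ τ))) (n∸n≡0 τ) w

  -- After i steps Divider keeps Facilitator from winning within clock i further steps: clock i is τ ∸ i under the
  -- deadline τ, and the constant N without a deadline.
  module _ (clock : ℕ → ℕ) (d₀ : Vec V k) (s∉d₀ : s ∉ᵥ d₀) (t∉d₀ : t ∉ᵥ d₀) where

    stay : ∀ q → DividerMove q
    stay q = D q , Pointwise.refl (inj₁ refl)

    Escape : ℕ → Position → Vec V k → Set
    Escape m q d = Pointwise (AgentMove (R q ∷ J q ∷ [])) (D q) d × ¬ Win m (position (R q) (J q) d)

    escape? : ∀ m q → Dec (∃ (Escape m q))
    escape? m q = any-complete? ∈-vectors λ d →
      Pointwise.decidable (agentMove? (R q ∷ J q ∷ [])) (D q) d ×-dec ¬? (win? m _)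

    reply : ∀ m q → Dec (∃ (Escape m q)) → DividerMove q
    reply m q (yes (d , legal , _)) = d , legal
    reply m q (no _)                = stay q

    evade : DividerStrategy
    evade = record
      { placement = d₀
      ; avoids-s  = s∉d₀
      ; avoids-t  = t∉d₀
      -- Divider's history has Facilitator's starting position of the current step on top, so it is
      -- never empty in a play. Below it lie the completed steps, and the reply completes one more,
      -- hence the `suc`.
      ; respond   = λ { []      q → stay q
                      ; (_ ∷ h) q → reply (clock (suc (rounds h))) q (escape? (clock (suc (rounds h))) q) }
      }

    -- If no reply escaped, every reply would lead into `Win m`, and Facilitator's move would itself
    -- witness `Win (suc m) p`.
    reply-evades : ∀ m p (f : FacilitatorMove p) (e? : Dec (∃ (Escape m (afterFacilitator p f)))) → ¬ Win (suc m) p →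
                   ¬ Win m (afterDivider (afterFacilitator p f) (reply m (afterFacilitator p f) e?))
    reply-evades m p f               (yes (d , _ , ¬w)) _   = ¬w
    reply-evades m p ((r , j) , legal) (no ¬∃)          ¬w _ =
      ¬w (inj₂ (r , j , legal , λ d l → decidable-stable (win? m _) λ ¬w′ → ¬∃ (d , l , ¬w′)))

    -- `progress` is required only below `i`: under a deadline it rests on
    -- `τ ∸ j = suc (τ ∸ suc j)`, which needs `j < τ`. For a constant clock it is stability.
    evades : ¬ Win (clock 0) (position s t d₀) → ∀ σ i →
             (∀ j → j < i → ∀ {p} → Win (suc (clock (suc j))) p → Win (clock j) p) →
             ¬ Win (clock i) (proj₂ (play σ evade i))
    evades ¬w σ zero    progress = ¬w
    evades ¬w σ (suc i) progress with play σ evade i in eq | evades ¬w σ i (λ j j<i → progress j (m≤n⇒m≤1+n j<i))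
    ... | h , p | ¬wᵢ = subst (λ v → ¬ Win (clock (suc i)) (afterDivider q (reply (clock (suc v)) q (escape? (clock (suc v)) q))))
                           (sym rounds≡)
                           (reply-evades (clock (suc i)) p (σ h p) (escape? _ q) λ w → ¬wᵢ (progress i ≤-refl w))
      where
      q = afterFacilitator p (σ h p)

      rounds≡ : rounds h ≡ i
      rounds≡ = trans (cong (rounds ∘ proj₁) (sym eq)) (rounds-play σ evade i)

  ¬winsAll⇒¬winsWithin : ∀ τ → ¬ WinsAll τ → ¬ FacilitatorWinsWithin τ
  ¬winsAll⇒¬winsWithin τ ¬all (σ , wins) with ¬winsAll⇒∃ τ ¬all
  ... | d , s∉ , t∉ , ¬w with wins (evade (τ ∸_) d s∉ t∉)
  ...   | i , i≤τ , met = evades (τ ∸_) d s∉ t∉ ¬w σ i progress (met⇒win (τ ∸ i) met)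
    where
    progress : ∀ j → j < i → ∀ {p} → Win (suc (τ ∸ suc j)) p → Win (τ ∸ j) p
    progress j j<i {p} = subst (λ v → Win v p) (sym (+-∸-assoc 1 (≤-trans j<i i≤τ)))

  winsAll⇒wins : WinsAll (length positions) → FacilitatorWins
  winsAll⇒wins all with winsAll⇒winsWithin (length positions) all
  ... | σ , wins = σ , λ δ → let i , _ , met = wins δ in i , met

  ¬winsAll⇒¬wins : ¬ WinsAll (length positions) → ¬ FacilitatorWins
  ¬winsAll⇒¬wins ¬all (σ , wins) with ¬winsAll⇒∃ (length positions) ¬all
  ... | d , s∉ , t∉ , ¬w with wins (evade (const (length positions)) d s∉ t∉)
  ...   | i , met = evades (const (length positions)) d s∉ t∉ ¬w σ i (λ _ _ → stable _) (met⇒win (length positions) met)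

-- Binary numerals

-- Numerals count as having size 0, since τ is not bounded in terms of n and k; a program can copy the pointer to a numeral
-- in constant time, but has to bound the number of digits that it reads.
numeral : Ty
numeral = base ℕᵇ encodeBinary λ _ → 0

numeralView : View numeral bool numeral
numeralView = record
  { uncons      = λ { 0ᵇ → nothing ; 1+[2 b ] → just (false , b) ; 2[1+ b ] → just (true , b) }
  ; enc-uncons  = λ { 0ᵇ → refl ; 1+[2 b ] → refl ; 2[1+ b ] → refl }
  ; size-uncons = λ _ _ → z≤n
  }

digits : ℕᵇ → List Bool
digits 0ᵇ       = []
digits 1+[2 b ] = false ∷ digits b
digits 2[1+ b ] = true ∷ digits b

value : List Bool → ℕ
value []           = 0
value (false ∷ ds) = suc (2 * value ds)
value (true ∷ ds)  = 2 * suc (value ds)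

value-digits : ∀ b → value (digits b) ≡ toℕᵇ b
value-digits 0ᵇ       = refl
value-digits 1+[2 b ] = cong (λ v → suc (2 * v)) (value-digits b)
value-digits 2[1+ b ] = cong (λ v → 2 * suc v) (value-digits b)

-- Numerals are short compared with their value, so the powers of two built up during the conversion
-- to unary are no larger than its result plus 1.
2^length≤value : ∀ ds → 2 ^ length ds ≤ suc (value ds)
2^length≤value []           = ≤-refl
2^length≤value (false ∷ ds) = ≤-trans (*-monoʳ-≤ 2 (2^length≤value ds)) (≤-reflexive (*-suc 2 (value ds)))
2^length≤value (true ∷ ds)  = ≤-trans (*-monoʳ-≤ 2 (2^length≤value ds)) (n≤1+n _)

value-++ : ∀ ds es → value ds ≤ value (ds ++ es)
value-++ []           es = z≤n
value-++ (false ∷ ds) es = s≤s (*-monoʳ-≤ 2 (value-++ ds es))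
value-++ (true ∷ ds)  es = *-monoʳ-≤ 2 (s≤s (value-++ ds es))

size-digits : ∀ b → size (list bool) (digits b) ≤ toℕᵇ b
size-digits 0ᵇ       = z≤n
size-digits 1+[2 b ] = s≤s (≤-trans (size-digits b) (m≤m+n _ _))
size-digits 2[1+ b ] = ≤-trans (s≤s (size-digits b)) (m≤m+n _ _)

module _ (f : A ⇒ numeral) (f≼ : toℕᵇ ∘ fun f ≼ size A) where
  private
    addDigit : ℕ × ℕ → Bool → ℕ × ℕ
    addDigit (w , n) d = w + w , n + (if d then w + w else w)

    foldl-addDigit : ∀ w n ds → foldl addDigit (w , n) ds ≡ (w * 2 ^ length ds , n + w * value ds)
    foldl-addDigit w n []           = cong₂ _,_ (sym (*-identityʳ w)) (sym (trans (cong (n +_) (*-zeroʳ w)) (+-identityʳ n)))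
    foldl-addDigit w n (d ∷ ds) = trans (foldl-addDigit (w + w) _ ds) (cong₂ _,_ weight (trans (+-assoc n _ _) (cong (n +_) (digit d))))
      where
      double : ∀ x → (w + w) * x ≡ w * (2 * x)
      double x = trans (cong (_* x) (trans (cong (w +_) (sym (+-identityʳ w))) (*-comm 2 w))) (*-assoc w 2 x)

      weight : (w + w) * 2 ^ length ds ≡ w * 2 ^ suc (length ds)
      weight = double _

      digit : ∀ d → (if d then w + w else w) + (w + w) * value ds ≡ w * value (d ∷ ds)
      digit false = trans (cong (w +_) (double (value ds))) (sym (*-suc w (2 * value ds)))
      digit true  = trans (sym (*-suc (w + w) (value ds))) (double (suc (value ds)))

    digitsₜ : A ⇒ list bool
    digitsₜ = recode f digits enc≡ (≼-mono (size-digits ∘ fun f) f≼)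
      where
      enc≡ : ∀ b → encodeBinary b ≡ enc (list bool) (digits b)
      enc≡ 0ᵇ       = refl
      enc≡ 1+[2 b ] = cong (_ ∙_) (enc≡ b)
      enc≡ 2[1+ b ] = cong (_ ∙_) (enc≡ b)

    -- The weight doubles in every round, so `fold⁺` does not apply. The closed form bounds the
    -- weight by 1 plus the value and the partial sum by the value, prefixes having smaller values.
    loop : A ⇒ nat ⊗ nat
    loop = fold ⟨ sucₜ zeroₜ , zeroₜ ⟩ digitsₜ
      ⟨ w +ₜ w , (sndₜ ⊙ sndₜ ⊙ fstₜ) +ₜ if sndₜ then w +ₜ w else w fi ⟩
      (≼-+ (≼-+ (≼-const 1) f≼) f≼) λ a ys zs eq →
        let v≤ : value ys ≤ toℕᵇ (fun f a)
            v≤ = ≤-trans (value-++ ys zs) (≤-reflexive (trans (cong value (sym eq)) (value-digits (fun f a))))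
        in subst (λ v → size (nat ⊗ nat) v ≤ 1 + toℕᵇ (fun f a) + toℕᵇ (fun f a)) (sym (foldl-addDigit 1 0 ys))
          (+-mono-≤ (≤-trans (≤-reflexive (+-identityʳ _)) (≤-trans (2^length≤value ys) (s≤s v≤)))
            (≤-trans (≤-reflexive (+-identityʳ _)) v≤))
      where
      w : A ⊗ (nat ⊗ nat) ⊗ bool ⇒ nat
      w = fstₜ ⊙ sndₜ ⊙ fstₜ

  toUnaryₜ : A ⇒ nat
  toUnaryₜ = withFun (sndₜ ⊙ loop) (toℕᵇ ∘ fun f) λ a →
    trans (cong proj₂ (foldl-addDigit 1 0 (digits (fun f a)))) (trans (+-identityʳ _) (value-digits (fun f a)))

-- The second hypothesis is stated with negations because that is what Divider's evading strategy
-- provides: without `WinsAll`, no strategy of Facilitator wins.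
reflects-iff : ∀ {P Q : Set} {b} → (P → Q) → (¬ P → ¬ Q) → Reflects P b → Reflects Q b
reflects-iff f g (ofʸ p)  = ofʸ (f p)
reflects-iff f g (ofⁿ ¬p) = ofⁿ (g ¬p)

map-reflects : ∀ {P Q : Set} {b} → (P → Q) → (Q → P) → Reflects P b → Reflects Q b
map-reflects f g = reflects-iff f (_∘ g)

half≤⇒ : ∀ m v → ⌊ m /2⌋ ≤ v → m ≤ suc (2 * v)
half≤⇒ zero          v       _       = z≤n
half≤⇒ (suc zero)    v       _       = s≤s z≤n
half≤⇒ (suc (suc m)) (suc v) (s≤s p) = s≤s (≤-trans (s≤s (half≤⇒ m v p)) (≤-reflexive (sym (*-suc 2 v))))

half≤⇐ : ∀ m v → m ≤ suc (2 * v) → ⌊ m /2⌋ ≤ v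
half≤⇐ zero          v       _ = z≤n
half≤⇐ (suc zero)    v       _ = z≤n
half≤⇐ (suc (suc m)) zero    (s≤s ())
half≤⇐ (suc (suc m)) (suc v) p = s≤s (half≤⇐ m v (s≤s⁻¹ (s≤s⁻¹ (≤-trans p (≤-reflexive (cong suc (*-suc 2 v)))))))

-- The loop subtracts the least significant digit of the numeral from m and halves the difference; m rounds suffice, so the
-- time does not depend on the numeral.
infix 7 _≤ₜ_
_≤ₜ_ : A ⇒ nat → A ⇒ numeral → A ⇒ bool
_≤ₜ_ {A} f g = (fstₜ ⊙ fold⁺ ⟨ f , g ⟩ (replicateₜ f) subtract (≼-const 0) grow) ≡ᵇₜ zeroₜ
  module LessEq where
  subtract : A ⊗ (nat ⊗ numeral) ⊗ unit ⇒ nat ⊗ numeral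
  subtract = case numeralView (sndₜ ⊙ sndₜ ⊙ fstₜ) (sndₜ ⊙ fstₜ)
    -- The halved difference has to be rounded up: ⌊m/2⌋ is (m - 1)/2 rounded up, for the digit 1,
    -- and ⌊(m - 1)/2⌋ is (m - 2)/2 rounded up, for the digit 2.
    ⟨ halfₜ (if sndₜ ⊙ fstₜ then predₜ m else m fi) , sndₜ ⟩
    where
    m : A ⊗ (nat ⊗ numeral) ⊗ unit ⊗ bool ⊗ numeral ⇒ nat
    m = fstₜ ⊙ sndₜ ⊙ fstₜ ⊙ fstₜ ⊙ fstₜ

  grow : ∀ a mb {x} → x ∈ _ → size (nat ⊗ numeral) (fun subtract ((a , mb) , x)) ≤ size (nat ⊗ numeral) mb + 0
  grow a (m , 0ᵇ)       _ = m≤m+n _ 0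
  grow a (m , 1+[2 b ]) _ = +-monoˡ-≤ 0 (≤-trans (⌊n/2⌋≤n m) (m≤m+n m 0))
  grow a (m , 2[1+ b ]) _ = +-monoˡ-≤ 0 (≤-trans (⌊n/2⌋≤n (pred m)) (≤-trans pred[n]≤n (m≤m+n m 0)))

  run : ⟦ A ⟧ → ℕ → ℕ × ℕᵇ → ℕ × ℕᵇ
  run a l mb = foldl (λ mb x → fun subtract ((a , mb) , x)) mb (replicate l tt)

  run-0 : ∀ a l m → run a l (m , 0ᵇ) ≡ (m , 0ᵇ)
  run-0 a zero    m = refl
  run-0 a (suc l) m = run-0 a l m

  -- While digits remain, each round lowers a positive `m` by at least one, so `m ≤ l` is preserved:
  -- when the rounds run out, `m` is 0 and the unread digits cannot matter.
  run-reflects : ∀ a l m b → m ≤ l → Reflects (m ≤ toℕᵇ b) (proj₁ (run a l (m , b)) ≡ᵇ 0)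
  run-reflects a l       zero    0ᵇ _ rewrite run-0 a l 0 = ofʸ z≤n
  run-reflects a l       (suc m) 0ᵇ _ rewrite run-0 a l (suc m) = ofⁿ λ ()
  run-reflects a zero    zero    1+[2 b ] _   = ofʸ z≤n
  run-reflects a zero    zero    2[1+ b ] _   = ofʸ z≤n
  run-reflects a (suc l) m       1+[2 b ] m≤l =
    map-reflects (half≤⇒ m (toℕᵇ b)) (half≤⇐ m (toℕᵇ b)) (run-reflects a l ⌊ m /2⌋ b (halved m m≤l))
    where
    halved : ∀ m → m ≤ suc l → ⌊ m /2⌋ ≤ l
    halved zero    _         = z≤n
    halved (suc m) (s≤s m≤l) = ≤-trans (s≤s⁻¹ (⌊n/2⌋<n m)) m≤l
  run-reflects a (suc l) m       2[1+ b ] m≤l =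
    map-reflects to from (run-reflects a l ⌊ pred m /2⌋ b (≤-trans (⌊n/2⌋≤n (pred m)) (pred-mono-≤ m≤l)))
    where
    to : ⌊ pred m /2⌋ ≤ toℕᵇ b → m ≤ 2 * suc (toℕᵇ b)
    to p = ≤-trans (suc-pred≤ m) (≤-trans (s≤s (half≤⇒ (pred m) (toℕᵇ b) p)) (≤-reflexive (sym (*-suc 2 (toℕᵇ b)))))
      where
      suc-pred≤ : ∀ m → m ≤ suc (pred m)
      suc-pred≤ zero    = z≤n
      suc-pred≤ (suc m) = ≤-refl

    from : m ≤ 2 * suc (toℕᵇ b) → ⌊ pred m /2⌋ ≤ toℕᵇ b
    from p = half≤⇐ (pred m) (toℕᵇ b) (pred-mono-≤ (≤-trans p (≤-reflexive (*-suc 2 (toℕᵇ b)))))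

≤ₜ-reflects : ∀ (f : A ⇒ nat) g a → Reflects (fun f a ≤ toℕᵇ (fun g a)) (fun (f ≤ₜ g) a)
≤ₜ-reflects f g a = LessEq.run-reflects f g a (fun f a) (fun f a) (fun g a) ≤-refl

-- The algorithm

-- A `pos` consists of `R`, `J` and Divider's agents. A `board` holds what stays fixed during the
-- computation: adjacency matrix, vertices, placements of Divider's agents and positions.
graph pos board : Ty
graph = list (list bool)
pos   = nat ⊗ nat ⊗ list nat
board = graph ⊗ list nat ⊗ list (list nat) ⊗ list pos

infixl 10 _↑
-- Nested pairs serve as contexts: `_↑` is weakening, and `#0`, `#1`, `#2` are de Bruijn variables.
_↑ : Γ ⇒ A → Γ ⊗ X ⇒ A
f ↑ = f ⊙ fstₜ

#0 : Γ ⊗ A ⇒ A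
#0 = sndₜ

#1 : Γ ⊗ A ⊗ X ⇒ A
#1 = #0 ↑

#2 : Γ ⊗ A ⊗ X ⊗ Y ⇒ A
#2 = #1 ↑

infixr 4 _→ₜ_
_→ₜ_ : A ⇒ bool → A ⇒ bool → A ⇒ bool
f →ₜ g = notₜ f ∨ₜ g

size-≤-length* : ∀ X b (xs : List ⟦ X ⟧) → (∀ {x} → x ∈ xs → size X x ≤ b) → size (list X) xs ≤ length xs * suc b
size-≤-length* X b []       ≤b = z≤n
size-≤-length* X b (x ∷ xs) ≤b = +-mono-≤ (s≤s (≤b (here refl))) (size-≤-length* X b xs (≤b ∘ there))

size-downFrom : ∀ {n} m → m ≤ n → size (list nat) (downFrom m) ≤ m * n
size-downFrom zero    _   = z≤n
size-downFrom (suc m) m<n = +-mono-≤ m<n (size-downFrom m (<⇒≤ m<n))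

verticesₜ : A ⇒ graph → A ⇒ list nat
verticesₜ {A} g = withFun (sndₜ ⊙ loop) (downFrom ∘ length ∘ fun g) λ a → cong proj₂ (count (fun g a))
  where
  next : ℕ × List ℕ → List Bool → ℕ × List ℕ
  next (m , vs) _ = suc m , m ∷ vs

  count-from : ∀ m xs → foldl next (m , downFrom m) xs ≡ (length xs + m , downFrom (length xs + m))
  count-from m []       = refl
  count-from m (x ∷ xs) = trans (count-from (suc m) xs) (cong (λ v → v , downFrom v) (+-suc (length xs) m))

  count : ∀ xs → foldl next (0 , []) xs ≡ (length xs , downFrom (length xs))
  count xs = trans (count-from 0 xs) (cong (λ v → v , downFrom v) (+-identityʳ (length xs)))

  loop : A ⇒ nat ⊗ list nat
  loop = fold ⟨ zeroₜ , []ₜ ⟩ g ⟨ sucₜ (fstₜ ⊙ #1) , fstₜ ⊙ #1 ∷ₜ sndₜ ⊙ #1 ⟩ (≼-+ (size≼ g) (≼-* (size≼ g) (size≼ g)))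
    λ a ys zs eq →
      let s  = size graph (fun g a)
          l≤ = ≤-trans (≤-trans (length≤size (list bool) ys) (size-++ (list bool) ys zs))
                       (≤-reflexive (cong (size graph) (sym eq)))
      in subst (λ v → size (nat ⊗ list nat) v ≤ s + s * s) (sym (count ys))
           (+-mono-≤ l≤ (≤-trans (size-downFrom (length ys) l≤) (*-monoˡ-≤ s l≤)))

head : ∀ {C : Set} → C → List C → C
head c []      = c
head _ (c ∷ _) = c

headₜ : (x : ⟦ X ⟧) → enc X x ≡ nil → A ⇒ list X → A ⇒ X
headₜ {X} {A} x eq xs = withFun (case listView xs (nilₜ x eq) #1) (head x ∘ fun xs) λ a → head≡ (fun xs a)
  where
  head≡ : ∀ xs → maybe (λ (x , _) → x) x (View.uncons (listView {X}) xs) ≡ head x xs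
  head≡ []      = refl
  head≡ (_ ∷ _) = refl

adjacentₜ : graph ⊗ nat ⊗ nat ⇒ bool
adjacentₜ = headₜ false refl (dropₜ #0 (headₜ [] refl (dropₜ #1 (fstₜ ↑))))

memberₜ : A ⇒ nat → A ⇒ list nat → A ⇒ bool
memberₜ v vs = anyₜ vs (v ↑ ≡ᵇₜ #0)

sameₜ : pos ⊗ pos ⇒ bool
sameₜ = ((fstₜ ⊙ fstₜ ⊙ fstₜ) ≡ᵇₜ (fstₜ ⊙ fstₜ ⊙ sndₜ) ∧ₜ (sndₜ ⊙ fstₜ ⊙ fstₜ) ≡ᵇₜ (sndₜ ⊙ fstₜ ⊙ sndₜ))
  ∧ₜ pairwiseₜ (sndₜ ⊙ fstₜ) (sndₜ ⊙ sndₜ) (#1 ≡ᵇₜ #0)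

elemₜ : A ⇒ pos → A ⇒ list pos → A ⇒ bool
elemₜ p ps = anyₜ ps (sameₜ ⊙ ⟨ p ↑ , #0 ⟩)

agentₜ : graph ⊗ list nat ⊗ nat ⊗ nat ⇒ bool
agentₜ = (#0 ≡ᵇₜ #1) ∨ₜ (adjacentₜ ⊙ ⟨ ⟨ fstₜ ↑ ↑ , #1 ⟩ , #0 ⟩ ∧ₜ notₜ (memberₜ #0 #2))

dividerₜ : graph ⊗ list nat ⊗ list nat ⊗ list nat ⇒ bool
dividerₜ = pairwiseₜ #1 #0 (agentₜ ⊙ ⟨ ⟨ ⟨ fstₜ ↑ ↑ ↑ ↑ , #2 ↑ ↑ ⟩ , #1 ⟩ , #0 ⟩)

winsₜ : board ⊗ list pos ⊗ pos ⇒ bool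
winsₜ = (R ≡ᵇₜ J) ∨ₜ anyₜ vs (anyₜ (vs ↑)
  ((agentₜ ⊙ ⟨ ⟨ ⟨ G ↑ ↑ , D ↑ ↑ ⟩ , R ↑ ↑ ⟩ , #1 ⟩ ∧ₜ agentₜ ⊙ ⟨ ⟨ ⟨ G ↑ ↑ , D ↑ ↑ ⟩ , J ↑ ↑ ⟩ , #0 ⟩)
   ∧ₜ allₜ (ds ↑ ↑) (dividerₜ ⊙ ⟨ ⟨ ⟨ G ↑ ↑ ↑ , #2 ∷ₜ #1 ∷ₜ []ₜ ⟩ , D ↑ ↑ ↑ ⟩ , #0 ⟩
                     →ₜ elemₜ ⟨ ⟨ #2 , #1 ⟩ , #0 ⟩ (#1 ↑ ↑ ↑))))
  where
  R J : board ⊗ list pos ⊗ pos ⇒ nat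
  R = fstₜ ⊙ fstₜ ⊙ #0
  J = sndₜ ⊙ fstₜ ⊙ #0

  D vs : board ⊗ list pos ⊗ pos ⇒ list nat
  D  = sndₜ ⊙ #0
  vs = #2 ⊙ fstₜ ↑

  G : board ⊗ list pos ⊗ pos ⇒ graph
  G = fstₜ ⊙ fstₜ ⊙ fstₜ ⊙ fstₜ ↑

  ds : board ⊗ list pos ⊗ pos ⇒ list (list nat)
  ds = #1 ⊙ fstₜ ↑

improveₜ : board ⊗ list pos ⇒ list pos
improveₜ = selectₜ (#0 ↑) (winsₜ ⊙ ⟨ fstₜ , #0 ⟩)

-- Each new list is selected from all positions, so its size does not depend on the previous list
-- `W` and repetition cannot blow it up.
size-improveₜ : ∀ b W → size (list pos) (fun improveₜ (b , W)) ≤ size (list pos) (proj₂ b)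
size-improveₜ b W = ≤-trans (size-select pos _ [] (proj₂ b)) (≤-reflexive (+-identityʳ _))

-- The list of positions doubles as the loop counter, giving one round per position; `below` freezes
-- the result when the deadline is reached.
roundsₜ : A ⇒ board → A ⊗ nat ⇒ bool → A ⇒ list pos ⊗ nat
roundsₜ {A} b below = fold⁺ ⟨ selectₜ (#0 ⊙ b) ((fstₜ ⊙ fstₜ ⊙ #0) ≡ᵇₜ (sndₜ ⊙ fstₜ ⊙ #0)) , zeroₜ ⟩ (#0 ⊙ b)
  (if below ⊙ ⟨ fstₜ ↑ , sndₜ ⊙ #1 ⟩ then ⟨ improveₜ ⊙ ⟨ b ↑ ↑ , fstₜ ⊙ #1 ⟩ , sucₜ (sndₜ ⊙ #1) ⟩ else #1 fi)
  (≼-+ (size≼ (#0 ⊙ b)) (≼-const 1))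
  λ a (W , i) _ → grow a W i (fun below (a , i))
  where
  ps : ⟦ A ⟧ → ℕ
  ps a = size (list pos) (proj₂ (fun b a))

  grow : ∀ a W i c → size (list pos ⊗ nat) (if c then (fun improveₜ (fun b a , W) , suc i) else (W , i))
                     ≤ size (list pos ⊗ nat) (W , i) + (ps a + 1)
  grow a W i false = m≤m+n _ _
  grow a W i true  = begin
    size (list pos) (fun improveₜ (fun b a , W)) + suc i ≤⟨ +-monoˡ-≤ (suc i) (size-improveₜ (fun b a) W) ⟩
    ps a + suc i                                         ≡⟨ cong (ps a +_) (+-comm 1 i) ⟩
    ps a + (i + 1)                                       ≡⟨ +-assoc (ps a) i 1 ⟨
    ps a + i + 1                                         ≡⟨ cong (_+ 1) (+-comm (ps a) i) ⟩
    i + ps a + 1                                         ≡⟨ +-assoc i (ps a) 1 ⟩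
    i + (ps a + 1)                                       ≤⟨ +-monoˡ-≤ (ps a + 1) (m≤n+m i (size (list pos) W)) ⟩
    size (list pos ⊗ nat) (W , i) + (ps a + 1)           ∎
    where open ≤-Reasoning

-- Testing `s ≡ᵇₜ t` on its own is essential: for `s = t` the board is built with 0 in place of `k`,
-- and its positions are not those of the game.
answerₜ : board ⊗ nat ⊗ nat ⊗ list pos ⇒ bool
answerₜ = (s ≡ᵇₜ t) ∨ₜ allₜ ds
  (notₜ (memberₜ (s ↑) #0) →ₜ notₜ (memberₜ (t ↑) #0) →ₜ elemₜ ⟨ ⟨ s ↑ , t ↑ ⟩ , #0 ⟩ #1)
  where
  s t : board ⊗ nat ⊗ nat ⊗ list pos ⇒ nat
  s = #2
  t = #1
  ds : board ⊗ nat ⊗ nat ⊗ list pos ⇒ list (list nat)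
  ds = #1 ⊙ fstₜ ↑ ↑

-- Correctness

any-reflects : ∀ {C : Set} {P : C → Set} {p} → (∀ x → Reflects (P x) (p x)) → ∀ xs → Reflects (Any P xs) (any p xs)
any-reflects r []       = ofⁿ λ ()
any-reflects r (x ∷ xs) = map-reflects
  (λ { (inj₁ p) → here p ; (inj₂ ps) → there ps }) (λ { (here p) → inj₁ p ; (there ps) → inj₂ ps })
  (r x ⊎-reflects any-reflects r xs)

all-any : ∀ {C : Set} (p : C → Bool) xs → all p xs ≡ not (any (not ∘ p) xs)
all-any p []       = refl
all-any p (x ∷ xs) with p x
... | true  = all-any p xs
... | false = refl

-- The codes may occur in any order and repeatedly; the two fields suffice to decide quantifiers
-- over `I` by `any` and `all` over `xs`.
record Enumerates {I C : Set} (f : I → C) (xs : List C) : Set where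
  field
    complete : ∀ a → f a ∈ xs
    sound    : ∀ {x} → x ∈ xs → ∃[ a ] x ≡ f a
open Enumerates

module _ {I C : Set} {f : I → C} where

  any-enumerated : ∀ {P : I → Set} {p xs} → Enumerates f xs → (∀ a → Reflects (P a) (p (f a))) → Reflects (∃ P) (any p xs)
  any-enumerated {P} {p} {xs} e r = map-reflects to from (any-reflects (λ x → T-reflects (p x)) xs)
    where
    to : Any (T ∘ p) xs → ∃ P
    to any with find any
    ... | x , x∈ , px with sound e x∈
    ...   | a , refl with p (f a) | r a
    ...     | true | ofʸ pa = a , pa

    from : ∃ P → Any (T ∘ p) xs
    from (a , pa) = lose (complete e a) holds
      where
      holds : T (p (f a))
      holds with p (f a) | r a
      ... | true  | _      = tt
      ... | false | ofⁿ ¬p = ¬p pa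

  all-enumerated : ∀ {P : I → Set} {p xs} → Enumerates f xs → (∀ a → Reflects (P a) (p (f a))) → Reflects (∀ a → P a) (all p xs)
  all-enumerated {P} {p} {xs} e r rewrite all-any p xs =
    map-reflects (λ ¬∃ a → decide (p (f a)) (r a) λ ¬p → ¬∃ (a , ¬p)) (λ ∀p (a , ¬p) → ¬p (∀p a))
      (¬-reflects (any-enumerated {P = ¬_ ∘ P} {p = not ∘ p} e (¬-reflects ∘ r)))
    where
    decide : ∀ {Q : Set} b → Reflects Q b → ¬ ¬ Q → Q
    decide true  (ofʸ q)  _  = q
    decide false (ofⁿ ¬q) ¬¬ = ⊥-elim (¬¬ ¬q)

  module _ {p : C → Bool} where

    select-acc : ∀ {x} acc xs → x ∈ acc → x ∈ select p acc xs
    select-acc acc []       x∈ = x∈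
    select-acc acc (y ∷ xs) x∈ with p y
    ... | true  = select-acc _ xs (there x∈)
    ... | false = select-acc _ xs x∈

    select-complete : ∀ {x} acc xs → x ∈ xs → p x ≡ true → x ∈ select p acc xs
    select-complete acc (x ∷ xs) (here refl) px rewrite px = select-acc _ xs (here refl)
    select-complete acc (y ∷ xs) (there x∈) px = select-complete _ xs x∈ px

    select-sound : ∀ {x} acc xs → x ∈ select p acc xs → x ∈ acc ⊎ p x ≡ true
    select-sound acc []       x∈ = inj₁ x∈
    select-sound acc (y ∷ xs) x∈ with p y in eq
    ... | false = select-sound acc xs x∈
    ... | true with select-sound (y ∷ acc) xs x∈
    ...   | inj₁ (here refl) = inj₂ eq
    ...   | inj₁ (there x∈′) = inj₁ x∈′
    ...   | inj₂ px          = inj₂ px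

  select-enumerated : ∀ {P : I → Set} {p xs} → Enumerates f xs → (∀ a → Reflects (P a) (p (f a))) →
                      ∀ a {b} → Reflects (f a ∈ select p [] xs) b → Reflects (P a) b
  select-enumerated {P} {p} {xs} e r a = map-reflects to from
    where
    to : f a ∈ select p [] xs → P a
    to x∈ with select-sound [] xs x∈
    ... | inj₂ px with p (f a) | r a
    ...   | true | ofʸ pa = pa

    from : P a → f a ∈ select p [] xs
    from pa = select-complete [] xs (complete e a) (det (r a) (ofʸ pa))

module _ {C D E : Set} (h : C → D → E) where

  row : List D → C → List E → List E
  row ys x acc = foldl (λ acc y → h x y ∷ acc) acc ys

  row-acc : ∀ {z x} ys acc → z ∈ acc → z ∈ row ys x acc
  row-acc []       acc z∈ = z∈
  row-acc (y ∷ ys) acc z∈ = row-acc ys _ (there z∈)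

  row-complete : ∀ {x y} ys acc → y ∈ ys → h x y ∈ row ys x acc
  row-complete (y ∷ ys) acc (here refl) = row-acc ys _ (here refl)
  row-complete (_ ∷ ys) acc (there y∈)  = row-complete ys _ y∈

  row-sound : ∀ {z x} ys acc → z ∈ row ys x acc → z ∈ acc ⊎ ∃[ y ] y ∈ ys × z ≡ h x y
  row-sound []       acc z∈ = inj₁ z∈
  row-sound (y ∷ ys) acc z∈ with row-sound ys _ z∈
  ... | inj₁ (here eq)        = inj₂ (y , here refl , eq)
  ... | inj₁ (there z∈′)      = inj₁ z∈′
  ... | inj₂ (y′ , y′∈ , eq)  = inj₂ (y′ , there y′∈ , eq)

  product-acc : ∀ {z} acc xs ys → z ∈ acc → z ∈ productWith h acc xs ys
  product-acc acc []       ys z∈ = z∈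
  product-acc acc (x ∷ xs) ys z∈ = product-acc _ xs ys (row-acc ys acc z∈)

  product-complete : ∀ {x y} acc xs ys → x ∈ xs → y ∈ ys → h x y ∈ productWith h acc xs ys
  product-complete acc (x ∷ xs) ys (here refl) y∈ = product-acc _ xs ys (row-complete ys acc y∈)
  product-complete acc (_ ∷ xs) ys (there x∈)  y∈ = product-complete _ xs ys x∈ y∈

  product-sound : ∀ {z} acc xs ys → z ∈ productWith h acc xs ys → z ∈ acc ⊎ ∃[ x ] ∃[ y ] x ∈ xs × y ∈ ys × z ≡ h x y
  product-sound acc []       ys z∈ = inj₁ z∈
  product-sound acc (x ∷ xs) ys z∈ with product-sound _ xs ys z∈
  ... | inj₂ (x′ , y , x′∈ , y∈ , eq) = inj₂ (x′ , y , there x′∈ , y∈ , eq)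
  ... | inj₁ z∈′ with row-sound ys acc z∈′
  ...   | inj₁ z∈″           = inj₁ z∈″
  ...   | inj₂ (y , y∈ , eq) = inj₂ (x , y , here refl , y∈ , eq)

  length-row : ∀ x ys acc → length (row ys x acc) ≡ length ys + length acc
  length-row x []       acc = refl
  length-row x (y ∷ ys) acc = trans (length-row x ys _) (+-suc (length ys) (length acc))

  length-productWith : ∀ acc xs ys → length (productWith h acc xs ys) ≡ length xs * length ys + length acc
  length-productWith acc []       ys = refl
  length-productWith acc (x ∷ xs) ys = trans (length-productWith _ xs ys) (trans (cong (length xs * length ys +_) (length-row x ys acc))
    (trans (sym (+-assoc (length xs * length ys) (length ys) (length acc))) (cong (_+ length acc) (+-comm (length xs * length ys) (length ys)))))

product-enumerates : ∀ {I J K C D E : Set} {f : I → C} {g : J → D} {e : K → E} {xs ys} (h : C → D → E) (pair : I → J → K) →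
                     (∀ i j → e (pair i j) ≡ h (f i) (g j)) → (∀ k → ∃[ i ] ∃[ j ] k ≡ pair i j) →
                     Enumerates f xs → Enumerates g ys → Enumerates e (productWith h [] xs ys)
product-enumerates {e = e} {xs} {ys} h pair e≡ split ef eg = record
  { complete = λ k → let i , j , eq = split k in
      subst (_∈ productWith h [] xs ys) (sym (trans (cong e eq) (e≡ i j)))
        (product-complete h [] xs ys (complete ef i) (complete eg j))
  ; sound    = λ z∈ → sound′ (product-sound h [] xs ys z∈)
  }
  where
  sound′ : ∀ {z} → z ∈ [] ⊎ (∃[ x ] ∃[ y ] x ∈ xs × y ∈ ys × z ≡ h x y) → ∃[ k ] z ≡ e k
  sound′ (inj₂ (x , y , x∈ , y∈ , eq)) with sound ef x∈ | sound eg y∈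
  ... | i , refl | j , refl = pair i j , trans eq (sym (e≡ i j))

vertices-enumerated : ∀ n → Enumerates (toℕ {n}) (downFrom n)
vertices-enumerated n = record
  { complete = λ v → ∈-downFrom⁺ (Fin.toℕ<n v)
  ; sound    = λ x∈ → let x<n = ∈-downFrom⁻ x∈ in fromℕ< x<n , sym (Fin.toℕ-fromℕ< x<n)
  }

codes : ∀ {n k} → Vec (Fin n) k → List ℕ
codes []      = []
codes (v ∷ d) = toℕ v ∷ codes d

words : List ℕ → ℕ → List (List ℕ)
words vs zero    = [] ∷ []
words vs (suc k) = productWith _∷_ [] vs (words vs k)

words-enumerated : ∀ n k → Enumerates (codes {n} {k}) (words (downFrom n) k)
words-enumerated n zero = record
  { complete = λ { [] → here refl }
  ; sound    = λ { (here eq) → [] , eq }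
  }
words-enumerated n (suc k) = product-enumerates _∷_ _∷_ (λ _ _ → refl) (λ { (v ∷ d) → v , d , refl })
  (vertices-enumerated n) (words-enumerated n k)

length-words : ∀ vs k → length (words vs k) ≡ length vs ^ k
length-words vs zero    = refl
length-words vs (suc k) = trans (length-productWith _∷_ [] vs (words vs k))
  (trans (+-identityʳ _) (cong (length vs *_) (length-words vs k)))

≡ᵇ-reflects : ∀ m n → Reflects (m ≡ n) (m ≡ᵇ n)
≡ᵇ-reflects m n = fromEquivalence (≡ᵇ⇒≡ m n) (≡⇒≡ᵇ m n)

vertex-reflects : ∀ {n} (u v : Fin n) → Reflects (u ≡ v) (toℕ u ≡ᵇ toℕ v)
vertex-reflects u v = map-reflects Fin.toℕ-injective (cong toℕ) (≡ᵇ-reflects _ _)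

pairwise-reflects-≡ : ∀ ds es → Reflects (ds ≡ es) (pairwise _≡ᵇ_ ds es)
pairwise-reflects-≡ []       []       = ofʸ refl
pairwise-reflects-≡ []       (e ∷ es) = ofⁿ λ ()
pairwise-reflects-≡ (d ∷ ds) []       = ofⁿ λ ()
pairwise-reflects-≡ (d ∷ ds) (e ∷ es) = map-reflects (λ (p , q) → cong₂ _∷_ p q) (λ { refl → refl , refl })
  (≡ᵇ-reflects d e ×-reflects pairwise-reflects-≡ ds es)

same-reflects : ∀ p q → Reflects (p ≡ q) (fun sameₜ (p , q))
same-reflects ((r , j) , d) ((r′ , j′) , d′) =
  map-reflects (λ { ((refl , refl) , refl) → refl }) (λ { refl → (refl , refl) , refl })
    ((≡ᵇ-reflects r r′ ×-reflects ≡ᵇ-reflects j j′) ×-reflects pairwise-reflects-≡ d d′)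

elem-reflects : ∀ (p : ⟦ pos ⟧) ps → Reflects (p ∈ ps) (any (λ q → fun sameₜ (p , q)) ps)
elem-reflects p ps = any-reflects (same-reflects p) ps

member-reflects : ∀ {n k} (v : Fin n) (d : Vec (Fin n) k) → Reflects (v ∈ᵥ d) (any (toℕ v ≡ᵇ_) (codes d))
member-reflects v []      = ofⁿ λ ()
member-reflects v (u ∷ d) = map-reflects (λ { (inj₁ p) → VAny.here p ; (inj₂ ps) → VAny.there ps })
  (λ { (VAny.here p) → inj₁ p ; (VAny.there ps) → inj₂ ps }) (vertex-reflects v u ⊎-reflects member-reflects v d)

head-drop-tabulate : ∀ {n} {C : Set} (c : C) (f : Fin n → C) u → head c (drop (toℕ u) (tabulate f)) ≡ f u
head-drop-tabulate c f Fin.zero    = refl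
head-drop-tabulate c f (Fin.suc u) = head-drop-tabulate c (f ∘ Fin.suc) u

graphCode : ∀ {n} → ConnectedGraph n → List (List Bool)
graphCode G = tabulate λ u → tabulate λ v → ConnectedGraph.adj G u v

module Correctness {n : ℕ} (G : ConnectedGraph n) (s t : Fin n) (k : ℕ) where
  open ConnectedGraph G
  open Game G s t k
  open Play G s t k

  posCode : Position → ⟦ pos ⟧
  posCode (position r j d) = (toℕ r , toℕ j) , codes d

  vs : List ℕ
  vs = downFrom n

  ds : List (List ℕ)
  ds = words vs k

  ps : List ⟦ pos ⟧
  ps = productWith _,_ [] (productWith _,_ [] vs vs) ds

  boardCode : ⟦ board ⟧
  boardCode = ((graphCode G , vs) , ds) , ps

  ps-enumerated : Enumerates posCode ps
  ps-enumerated = product-enumerates _,_ (λ (r , j) → position r j) (λ _ _ → refl) (λ { (position r j d) → (r , j) , d , refl })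
    (product-enumerates {e = λ (r , j) → toℕ r , toℕ j} _,_ _,_ (λ _ _ → refl) (λ (r , j) → r , j , refl)
      (vertices-enumerated n) (vertices-enumerated n))
    (words-enumerated n k)

  length-ps : length ps ≡ length positions
  length-ps = trans (length-productWith _,_ [] (productWith _,_ [] vs vs) ds)
    (trans (+-identityʳ _) (trans (cong₂ _*_ (trans (length-productWith _,_ [] vs vs) (trans (+-identityʳ _)
      (cong₂ _*_ (length-downFrom n) (length-downFrom n)))) (trans (length-words vs k) (cong (_^ k) (length-downFrom n))))
      (sym length-positions)))

  adjacent-correct : ∀ u v → fun adjacentₜ ((graphCode G , toℕ u) , toℕ v) ≡ adj u v
  adjacent-correct u v = trans (cong (head false ∘ drop (toℕ v)) (head-drop-tabulate [] (λ u → tabulate (adj u)) u))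
    (head-drop-tabulate false (adj u) v)

  agent-reflects : ∀ {m} (opp : Vec V m) u v →
                   Reflects (AgentMove opp u v) (fun agentₜ (((graphCode G , codes opp) , toℕ u) , toℕ v))
  agent-reflects opp u v = vertex-reflects v u ⊎-reflects
    (subst (Reflects (Adjacent u v)) (sym (adjacent-correct u v)) (T-reflects (adj u v))
     ×-reflects ¬-reflects (member-reflects v opp))

  divider-reflects : ∀ {m l} (opp : Vec V m) (d d′ : Vec V l) →
                     Reflects (Pointwise (AgentMove opp) d d′) (fun dividerₜ (((graphCode G , codes opp) , codes d) , codes d′))
  divider-reflects opp []      []        = ofʸ []
  divider-reflects opp (u ∷ d) (v ∷ d′) = map-reflects (λ (m , ms) → m ∷ ms) (λ { (m ∷ ms) → m , ms })
    (agent-reflects opp u v ×-reflects divider-reflects opp d d′)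

  -- Equivalence of membership in `W` and `Win i`, phrased so that any Boolean test of the former is
  -- at once a test of the latter.
  Represents : List ⟦ pos ⟧ → ℕ → Set
  Represents W i = ∀ p {b} → Reflects (posCode p ∈ W) b → Reflects (Win i p) b

  wins-reflects : ∀ {W i} → Represents W i → ∀ p → Reflects (Win (suc i) p) (fun winsₜ ((boardCode , W) , posCode p))
  wins-reflects {W} rep (position R J D) = vertex-reflects R J ⊎-reflects
    any-enumerated (vertices-enumerated n) λ r → any-enumerated (vertices-enumerated n) λ j →
      (agent-reflects D R r ×-reflects agent-reflects D J j) ×-reflects
      all-enumerated (words-enumerated n k) λ d →
        divider-reflects (r ∷ j ∷ []) D d →-reflects rep (position r j d) (elem-reflects _ W)

  improve-represents : ∀ {W i} → Represents W i → Represents (fun improveₜ (boardCode , W)) (suc i)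
  improve-represents rep = select-enumerated ps-enumerated (wins-reflects rep)

  -- Asking for a correct `below` only at indices under the number of positions lets the constant
  -- `trueₜ` act as the deadline test when `τ` is that number.
  module _ {A : Ty} (b : A ⇒ board) (below : A ⊗ nat ⇒ bool) (a : ⟦ A ⟧) (τ : ℕ)
           (b≡ : fun b a ≡ boardCode)
           (below-reflects : ∀ i → i < length ps → Reflects (i < τ) (fun below (a , i))) where

    rounds-represents : Represents (proj₁ (fun (roundsₜ b below) a)) (length ps ⊓ τ)
    rounds-represents rewrite b≡ = loop _ 0 ps z≤n ≤-refl
      (select-enumerated ps-enumerated λ (position r j _) → vertex-reflects r j)
      where
      next : List ⟦ pos ⟧ × ℕ → ⟦ pos ⟧ → List ⟦ pos ⟧ × ℕ
      next (W , i) _ = if fun below (a , i) then (fun improveₜ (boardCode , W) , suc i) else (W , i)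

      -- Once `below` answers false, `i` has reached `τ`, the state no longer changes, and the
      -- minimum is `τ` however many rounds remain.
      loop : ∀ W i qs → i ≤ τ → i + length qs ≤ length ps → Represents W i →
             Represents (proj₁ (foldl next (W , i) qs)) ((i + length qs) ⊓ τ)
      loop W i []       i≤τ _ rep = subst (Represents W) (sym (trans (cong (_⊓ τ) (+-identityʳ i)) (m≤n⇒m⊓n≡m i≤τ))) rep
      loop W i (q ∷ qs) i≤τ i≤ rep
        with fun below (a , i) | below-reflects i (≤-trans (s≤s (m≤m+n i _)) (≤-trans (≤-reflexive (sym (+-suc i _))) i≤))
      ... | true  | ofʸ i<τ rewrite +-suc i (length qs) = loop _ (suc i) qs i<τ i≤ (improve-represents rep)
      ... | false | ofⁿ i≮τ = subst (Represents _) eq (loop W i qs i≤τ (≤-trans (+-monoʳ-≤ i (n≤1+n _)) i≤) rep)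
        where
        τ≤i = ≮⇒≥ i≮τ
        eq : (i + length qs) ⊓ τ ≡ (i + suc (length qs)) ⊓ τ
        eq = trans (m≥n⇒m⊓n≡n (≤-trans τ≤i (m≤m+n i _))) (sym (m≥n⇒m⊓n≡n (≤-trans τ≤i (m≤m+n i _))))

  answer-reflects : ∀ {W i} → Represents W i → Reflects (WinsAll i) (fun answerₜ (((boardCode , toℕ s) , toℕ t) , W))
  answer-reflects {W} {i} rep = map-reflects [ (λ eq _ _ _ → met⇒win i eq) , id ]′ inj₂
    (vertex-reflects s t ⊎-reflects all-enumerated (words-enumerated n k) λ d →
      ¬-reflects (member-reflects s d) →-reflects
        (¬-reflects (member-reflects t d) →-reflects rep (position s t d) (elem-reflects _ W)))

-- Instances

positionsBound : RendezvousInstance → ℕ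
positionsBound I = n ^ k
  where open RendezvousInstance I

instance₁ instance₂ : Ty
instance₁ = base RendezvousInstance (Problem.encode Rendezvous) positionsBound
instance₂ = base RendezvousInTimeInstance (Problem.encode RendezvousInTime)
  (positionsBound ∘ RendezvousInTimeInstance.rendezvousInstance)

forgetTimeₜ : instance₂ ⇒ instance₁
forgetTimeₜ = prim RendezvousInTimeInstance.rendezvousInstance
  (λ x → cons (hd (var x)) (cons (hd (tl (var x))) (cons (hd (tl (tl (var x)))) (cons (hd (tl (tl (tl (var x))))) nil))))
  19 (λ _ → ≤-refl)
  (λ x ρ I eq → cong (λ a → left a ∙ left (right a) ∙ left (right (right a)) ∙ left (right (right (right a))) ∙ nil) eq)
  ≼-refl

timeₜ : instance₂ ⇒ numeral
timeₜ = prim (fromℕ ∘ RendezvousInTimeInstance.τ) (λ x → hd (tl (tl (tl (tl (var x)))))) 6 (λ _ → ≤-refl)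
  (λ x ρ I eq → cong (λ a → left (right (right (right (right a))))) eq) (≼-const 0)

n>0 : ∀ {n} → Fin n → n > 0
n>0 {suc n} _ = s≤s z≤n

module _ (I : RendezvousInstance) where
  open RendezvousInstance I

  n≤n^k : n ≤ n ^ k
  n≤n^k = ≤-trans (≤-reflexive (sym (^-identityʳ n))) (^-monoʳ-≤ n ⦃ >-nonZero (n>0 s) ⦄ 1≤k)

  vertex≤n^k : ∀ (v : Fin n) → toℕ v ≤ n ^ k
  vertex≤n^k v = ≤-trans (<⇒≤ (Fin.toℕ<n v)) n≤n^k

  kCode : ℕᵇ
  kCode = if toℕ s ≡ᵇ toℕ t then 0ᵇ else fromℕ k

  kCode≤k : toℕᵇ kCode ≤ k
  kCode≤k with toℕ s ≡ᵇ toℕ t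
  ... | true  = z≤n
  ... | false = ≤-reflexive (toℕ-fromℕ k)

  -- Distinct `s` and `t` force `n ≥ 2`, so `k ≤ 2 ^ k ≤ n ^ k`.
  kCode≤n^k : toℕᵇ kCode ≤ n ^ k
  kCode≤n^k with toℕ s ≡ᵇ toℕ t | vertex-reflects s t
  ... | true  | _       = z≤n
  ... | false | ofⁿ s≢t = ≤-trans (≤-reflexive (toℕ-fromℕ k)) (≤-trans (n≤2^n k) (^-monoˡ-≤ k (two s t s≢t)))
    where
    two : ∀ {n} (u v : Fin n) → u ≢ v → 2 ≤ n
    two {suc zero}    Fin.zero Fin.zero u≢v = contradiction refl u≢v
    two {suc (suc n)} _        _        _   = s≤s (s≤s z≤n)

graphₜ : instance₁ ⇒ graph
graphₜ = prim (graphCode ∘ RendezvousInstance.G) (λ x → hd (var x)) 2 (λ _ → ≤-refl)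
  (λ x ρ I eq → trans (cong left eq) (enc-rows (ConnectedGraph.adj (RendezvousInstance.G I))))
  (≼-mono (λ I → size-rows I) (≼-* ≼-refl (≼-+ (≼-const 1) (≼-* ≼-refl (≼-const 1)))))
  where
  enc-tabulate : ∀ X {n} (f : Fin n → ⟦ X ⟧) → encodeList (tabulate λ u → enc X (f u)) ≡ enc (list X) (tabulate f)
  enc-tabulate X {zero}  f = refl
  enc-tabulate X {suc n} f = cong (enc X (f Fin.zero) ∙_) (enc-tabulate X (f ∘ Fin.suc))

  encodeList-cong : ∀ {n} {f g : Fin n → Tree} → (∀ u → f u ≡ g u) → encodeList (tabulate f) ≡ encodeList (tabulate g)
  encodeList-cong {zero}  f≡g = refl
  encodeList-cong {suc n} f≡g = cong₂ _∙_ (f≡g Fin.zero) (encodeList-cong (f≡g ∘ Fin.suc))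

  enc-rows : ∀ {m n} (adj : Fin m → Fin n → Bool) →
             encodeList (tabulate λ u → encodeList (tabulate λ v → encodeBool (adj u v)))
             ≡ enc graph (tabulate λ u → tabulate λ v → adj u v)
  enc-rows adj = trans (encodeList-cong λ u → enc-tabulate bool (adj u)) (enc-tabulate (list bool) (λ u → tabulate (adj u)))

  size-tabulate : ∀ X {n} (f : Fin n → ⟦ X ⟧) b → (∀ u → size X (f u) ≤ b) → size (list X) (tabulate f) ≤ n * suc b
  size-tabulate X {zero}  f b f≤ = z≤n
  size-tabulate X {suc n} f b f≤ = +-mono-≤ (s≤s (f≤ Fin.zero)) (size-tabulate X (f ∘ Fin.suc) b (f≤ ∘ Fin.suc))

  size-rows : ∀ I → size graph (graphCode (RendezvousInstance.G I)) ≤ positionsBound I * (1 + positionsBound I * 1)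
  size-rows I = ≤-trans (size-tabulate (list bool) _ (n * 1) λ u → size-tabulate bool (ConnectedGraph.adj G u) 0 λ _ → z≤n)
    (*-mono-≤ (n≤n^k I) (s≤s (*-monoˡ-≤ 1 (n≤n^k I))))
    where open RendezvousInstance I

sₜ tₜ : instance₁ ⇒ nat
sₜ = prim (λ I → toℕ (RendezvousInstance.s I)) (λ x → hd (tl (var x))) 3 (λ _ → ≤-refl)
  (λ x ρ I eq → cong (left ∘ right) eq) (≼-mono (λ I → vertex≤n^k I (RendezvousInstance.s I)) ≼-refl)
tₜ = prim (λ I → toℕ (RendezvousInstance.t I)) (λ x → hd (tl (tl (var x)))) 4 (λ _ → ≤-refl)
  (λ x ρ I eq → cong (left ∘ right ∘ right) eq) (≼-mono (λ I → vertex≤n^k I (RendezvousInstance.t I)) ≼-refl)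

-- For s = t the number k is taken to be 0, since for n = 1 it is not bounded in terms of n ^ k.
kₜ : instance₁ ⇒ nat
kₜ = toUnaryₜ
  (if sₜ ≡ᵇₜ tₜ then nilₜ 0ᵇ refl
   else prim (fromℕ ∘ RendezvousInstance.k) (λ x → hd (tl (tl (tl (var x))))) 5 (λ _ → ≤-refl)
          (λ x ρ I eq → cong (left ∘ right ∘ right ∘ right) eq) (≼-const 0) fi)
  (≼-mono kCode≤n^k ≼-refl)

-- A round multiplies the number of words by `n`, so the size is bounded through the closed form:
-- after `j` rounds there are `n ^ j` words of size at most `j * n`.
wordsₜ : instance₁ ⇒ list (list nat)
wordsₜ = withFun
  (fold ([]ₜ ∷ₜ []ₜ) (replicateₜ kₜ) (productWithₜ (verticesₜ graphₜ ↑ ↑) #1 (#1 ∷ₜ #0))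
    (≼-* ≼-refl (≼-+ (≼-const 1) (≼-* ≼-refl ≼-refl))) bounded)
  (λ I → words (vertices I) (fun kₜ I)) λ I →
    trans (iterate (vertices I) 0 (replicate (fun kₜ I) tt))
      (cong (words (vertices I)) (trans (+-identityʳ _) (length-replicate (fun kₜ I))))
  where
  vertices : RendezvousInstance → List ℕ
  vertices I = downFrom (length (graphCode (RendezvousInstance.G I)))

  iterate : ∀ vs j (ys : List ⊤) → foldl (λ ws _ → productWith _∷_ [] vs ws) (words vs j) ys ≡ words vs (length ys + j)
  iterate vs j []       = refl
  iterate vs j (y ∷ ys) = trans (iterate vs (suc j) ys) (cong (words vs) (+-suc (length ys) j))

  size-word : ∀ n j {w} → w ∈ words (downFrom n) j → size (list nat) w ≤ j * n
  size-word n zero    (here refl) = z≤n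
  size-word n (suc j) w∈ with product-sound _∷_ [] (downFrom n) (words (downFrom n) j) w∈
  ... | inj₂ (v , w′ , v∈ , w′∈ , refl) with sound (vertices-enumerated n) v∈
  ...   | u , refl = +-mono-≤ (Fin.toℕ<n u) (size-word n j w′∈)

  size-words : ∀ n j → size (list (list nat)) (words (downFrom n) j) ≤ n ^ j * suc (j * n)
  size-words n j = ≤-trans (size-≤-length* (list nat) (j * n) (words (downFrom n) j) (size-word n j))
    (≤-reflexive (cong (_* suc (j * n)) (trans (length-words (downFrom n) j) (cong (_^ j) (length-downFrom n)))))

  bounded : ∀ I ys zs → replicate (fun kₜ I) tt ≡ ys ++ zs →
            size (list (list nat)) (foldl (λ ws _ → productWith _∷_ [] (vertices I) ws) ([] ∷ []) ys)
            ≤ positionsBound I * suc (positionsBound I * positionsBound I)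
  bounded I ys zs eq = begin
    size (list (list nat)) (foldl (λ ws _ → productWith _∷_ [] (vertices I) ws) ([] ∷ []) ys)
      ≡⟨ cong (size (list (list nat))) (iterate (vertices I) 0 ys) ⟩
    size (list (list nat)) (words (vertices I) (length ys + 0))
      ≡⟨ cong₂ (λ m j → size (list (list nat)) (words (downFrom m) j))
           (length-tabulate (λ u → tabulate (ConnectedGraph.adj G u))) (+-identityʳ (length ys)) ⟩
    size (list (list nat)) (words (downFrom n) (length ys))
      ≤⟨ size-words n (length ys) ⟩
    n ^ length ys * suc (length ys * n)
      -- The number of rounds occurs twice: as an exponent it must be at most `k`, as a factor at
      -- most `n ^ k`.
      ≤⟨ *-mono-≤ (^-monoʳ-≤ n ⦃ >-nonZero (n>0 s) ⦄ (≤-trans j≤ (kCode≤k I)))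
           (s≤s (*-mono-≤ (≤-trans j≤ (kCode≤n^k I)) (n≤n^k I))) ⟩
    n ^ k * suc (n ^ k * n ^ k) ∎
    where
    open RendezvousInstance I
    open ≤-Reasoning
    j≤ : length ys ≤ toℕᵇ (kCode I)
    j≤ = ≤-trans (m≤m+n (length ys) (length zs))
      (≤-reflexive (trans (sym (length-++ ys)) (trans (cong length (sym eq)) (length-replicate (fun kₜ I)))))

boardₜ : instance₁ ⇒ board
boardₜ = positionsₜ ⊙ ⟨ ⟨ graphₜ , verticesₜ graphₜ ⟩ , wordsₜ ⟩
  where
  positionsₜ : graph ⊗ list nat ⊗ list (list nat) ⇒ board
  positionsₜ = ⟨ idₜ , productWithₜ (productWithₜ #1 #1 ⟨ #1 , #0 ⟩) #0 ⟨ #1 , #0 ⟩ ⟩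

solveₜ : A ⇒ instance₁ → A ⊗ nat ⇒ bool → A ⇒ bool
solveₜ i below = answerₜ ⊙ ⟨ ⟨ ⟨ boardₜ ⊙ i , sₜ ⊙ i ⟩ , tₜ ⊙ i ⟩ , fstₜ ⊙ roundsₜ (boardₜ ⊙ i) below ⟩

answer-met : ∀ b W {u v} → u ≡ v → fun answerₜ (((b , u) , v) , W) ≡ true
answer-met b W {u} refl rewrite ≡ᵇ-refl u = refl

module _ {A : Ty} (i : A ⇒ instance₁) (below : A ⊗ nat ⇒ bool) (a : ⟦ A ⟧) (τ : ℕ) where
  private
    I = fun i a
  open RendezvousInstance I
  open Play G s t k
  open Correctness G s t k

  solve-reflects : (∀ j → j < length positions → Reflects (j < τ) (fun below (a , j))) →
                   Reflects (WinsAll (length positions ⊓ τ)) (fun (solveₜ i below) a)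
  solve-reflects below-reflects with s Fin.≟ t
  ... | yes s≡t = subst (Reflects _)
                    (sym (answer-met (fun boardₜ I) (proj₁ (fun (roundsₜ (boardₜ ⊙ i) below) a)) (cong toℕ s≡t)))
                    (ofʸ λ d _ _ → met⇒win (length positions ⊓ τ) s≡t)
  ... | no s≢t = subst (λ l → Reflects (WinsAll (l ⊓ τ)) (fun (solveₜ i below) a)) length-ps
      (subst (λ b → Reflects (WinsAll (length ps ⊓ τ))
                      (fun answerₜ (((b , toℕ s) , toℕ t) , proj₁ (fun (roundsₜ (boardₜ ⊙ i) below) a))))
        (sym board≡)
        (answer-reflects {proj₁ (fun (roundsₜ (boardₜ ⊙ i) below) a)} {length ps ⊓ τ}
          (rounds-represents (boardₜ ⊙ i) below a τ board≡ λ j j< → below-reflects j (≤-trans j< (≤-reflexive length-ps)))))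
    where
    k≡ : fun kₜ I ≡ k
    k≡ = trans (cong (λ b → toℕᵇ (if b then 0ᵇ else fromℕ k)) (det (vertex-reflects s t) (ofⁿ s≢t))) (toℕ-fromℕ k)

    board≡ : fun boardₜ I ≡ boardCode
    board≡ = cong₂ (λ m l → let vs = downFrom m; ds = words vs l in
                      ((graphCode G , vs) , ds) , productWith _,_ [] (productWith _,_ [] vs vs) ds)
               (length-tabulate λ u → tabulate (ConnectedGraph.adj G u)) k≡

-- From polynomial programs to deciders

^-distribʳ-* : ∀ m n o → (m * n) ^ o ≡ m ^ o * n ^ o
^-distribʳ-* m n zero    = refl
^-distribʳ-* m n (suc o) = trans (cong (m * n *_) (^-distribʳ-* m n o)) ([m*n]*[o*p]≡[m*o]*[n*p] m n (m ^ o) (n ^ o))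

decider : ∀ (Π : Problem) (n k : Problem.Instance Π → ℕ) → (∀ I → n I > 0) →
          (f : base (Problem.Instance Π) (Problem.encode Π) (λ I → n I ^ k I) ⇒ bool) →
          (∀ I → Reflects (Problem.Yes Π I) (fun f I)) →
          Σ[ P ∈ Program ] Σ[ C ∈ ℕ ] Σ[ c ∈ ℕ ] DecidesInTime P Π (λ I → C * n I ^ (c * k I))
decider Π n k n>0 f reflects = code f 0 , 3 ^ d , d , record { decides = decides }
  where
  open Problem Π
  d = degree (time≼ f)

  in-time : ∀ I → time f I ≤ 3 ^ d * n I ^ (d * k I)
  in-time I = begin
    time f I                 ≤⟨ bound (time≼ f) I ⟩
    -- Since `x = n ^ k` is at least 1, the summand 2 is at most `2 * x`; this is the origin of the
    -- constant `3 ^ d`.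
    (2 + x) ^ d              ≤⟨ ^-monoˡ-≤ d (+-monoˡ-≤ x (*-monoʳ-≤ 2 x>0)) ⟩
    (2 * x + x) ^ d          ≡⟨ cong (_^ d) (+-comm (2 * x) x) ⟩
    (3 * x) ^ d              ≡⟨ ^-distribʳ-* 3 x d ⟩
    3 ^ d * x ^ d            ≡⟨ cong (3 ^ d *_) (^-*-assoc (n I) (k I) d) ⟩
    3 ^ d * n I ^ (k I * d)  ≡⟨ cong (λ e → 3 ^ d * n I ^ e) (*-comm (k I) d) ⟩
    3 ^ d * n I ^ (d * k I)  ∎
    where
    open ≤-Reasoning
    x = n I ^ k I
    x>0 : 1 ≤ x
    x>0 = m^n>0 (n I) ⦃ >-nonZero (n>0 I) ⦄ (k I)

  verdict : ∀ {Q : Set} {b a} → Reflects Q b → a ≡ encodeBool b →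
            (a ≡ encodeBool true × Q) ⊎ (a ≡ encodeBool false × ¬ Q)
  verdict (ofʸ q)  eq = inj₁ (eq , q)
  verdict (ofⁿ ¬q) eq = inj₂ (eq , ¬q)

  decides : ∀ I → ∃[ m ] ∃[ ρ ] ⟨ code f 0 , initial (encode I) ⟩⇓[ m ] ρ × m ≤ 3 ^ d * n I ^ (d * k I)
                  × ((output ρ ≡ encodeBool true × Yes I) ⊎ (output ρ ≡ encodeBool false × ¬ Yes I))
  decides I with runs f 0 (initial (encode I)) I refl
  ... | m , ρ , halts , m≤ , out , _ = m , ρ , halts , ≤-trans m≤ (in-time I) , verdict (reflects I) out

rendezvousₜ : instance₁ ⇒ bool
rendezvousₜ = solveₜ idₜ trueₜ

rendezvousInTimeₜ : instance₂ ⇒ bool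
rendezvousInTimeₜ = solveₜ forgetTimeₜ (sucₜ sndₜ ≤ₜ timeₜ ⊙ fstₜ)

rendezvous-reflects : ∀ I → Reflects (Problem.Yes Rendezvous I) (fun rendezvousₜ I)
rendezvous-reflects I = reflects-iff winsAll⇒wins ¬winsAll⇒¬wins
  (subst (λ l → Reflects (WinsAll l) (fun rendezvousₜ I)) (⊓-idem (length positions))
    (solve-reflects idₜ trueₜ I (length positions) λ j j< → ofʸ j<))
  where
  open RendezvousInstance I
  open Play G s t k

rendezvousInTime-reflects : ∀ I → Reflects (Problem.Yes RendezvousInTime I) (fun rendezvousInTimeₜ I)
rendezvousInTime-reflects I = reflects-iff (winsAll⇒winsWithin τ ∘ widen) (λ ¬all → ¬winsAll⇒¬winsWithin τ (¬all ∘ narrow))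
  (solve-reflects forgetTimeₜ (sucₜ sndₜ ≤ₜ timeₜ ⊙ fstₜ) I τ λ j _ →
    subst (λ m → Reflects (j < m) (fun (sucₜ sndₜ ≤ₜ timeₜ ⊙ fstₜ) (I , j))) (toℕ-fromℕ τ)
      (≤ₜ-reflects (sucₜ sndₜ) (timeₜ ⊙ fstₜ) (I , j)))
  where
  open RendezvousInTimeInstance I
  open Play G s t k

  widen : WinsAll (length positions ⊓ τ) → WinsAll τ
  widen all d s∉ t∉ = monotone (m⊓n≤n (length positions) τ) (all d s∉ t∉)

  -- If the number of positions is the minimum, this is stabilisation: positions won within `τ`
  -- steps are won within that number.
  narrow : WinsAll τ → WinsAll (length positions ⊓ τ)
  narrow all d s∉ t∉ with ⊓-sel (length positions) τ
  ... | inj₁ eq = subst (λ i → Win i (Game.position s t d)) (sym eq) (reached τ (all d s∉ t∉))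
  ... | inj₂ eq = subst (λ i → Win i (Game.position s t d)) (sym eq) (all d s∉ t∉)

theorem1 : (Σ[ P ∈ Program ] Σ[ C ∈ ℕ ] Σ[ c ∈ ℕ ]
    DecidesInTime P Rendezvous
    (λ I → let open RendezvousInstance I in C * n ^ (c * k)))
    ×
    (Σ[ P ∈ Program ] Σ[ C ∈ ℕ ] Σ[ c ∈ ℕ ]
    DecidesInTime P RendezvousInTime
    (λ I → let open RendezvousInTimeInstance I in C * n ^ (c * k)))
theorem1 =
  decider Rendezvous RendezvousInstance.n RendezvousInstance.k (n>0 ∘ RendezvousInstance.s) rendezvousₜ rendezvous-reflects ,
  decider RendezvousInTime RendezvousInTimeInstance.n RendezvousInTimeInstance.k (n>0 ∘ RendezvousInTimeInstance.s)
    rendezvousInTimeₜ rendezvousInTime-reflects
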